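{- For all integers $t$ and $d$ with $1<d<t$, we have $s(H_{t,d})=d^2$.
   Context: All graphs are finite and simple. For graphs $F$ and $H$, write $F\to H$ ($F$ is Ramsey for $H$) if every coloring of the edges of $F$ with two colors (red and blue) contains a monochromatic copy of $H$ (a copy means a not necessarily induced subgraph isomorphic to $H$). $F$ is Ramsey $H$-minimal if $F\to H$ and no proper subgraph $F'$ of $F$ satisfies $F'\to H$; $\mathcal{M}(H)$ is the set of Ramsey $H$-minimal graphs. Define $s(H)=\min_{F\in\mathcal{M}(H)}\delta(F)$, where $\delta(F)$ is the minimum degree of $F$. For $0\le d\le t$, $H_{t,d}$ is the graph on $t+1$ vertices consisting of a complete graph $K_t$ together with one additional vertex adjacent to exactly $d$ vertices of the $K_t$. -}

module Defs where

open import Data.Nat using (ℕ; zero; suc; _+_; _*_; _≤_; _<ᵇ_; _≡ᵇ_)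
open import Data.Bool using (Bool; true; false; not; _∧_; _∨_; if_then_else_)
open import Data.Bool.Properties using (∨-comm)
open import Data.Fin using (Fin; toℕ; _≟_)
open import Data.List using (List; map; allFin)
open import Data.Nat.ListAction using (sum)
open import Data.Product using (Σ; _×_; _,_; ∃)
open import Function.Definitions using (Injective; Surjective)
open import Relation.Nullary using (¬_; yes; no; Dec)
open import Relation.Nullary.Decidable using (⌊_⌋)
open import Relation.Binary.PropositionalEquality using (_≡_; refl; sym; cong₂)

record Graph : Set where
  field
    n    : ℕ
    E    : Fin n → Fin n → Bool
    symE : ∀ i j → E i j ≡ E j i
    irr  : ∀ i → E i i ≡ false
open Graph public

private
  ≟-sym : ∀ {n} (i j : Fin n) → ⌊ i ≟ j ⌋ ≡ ⌊ j ≟ i ⌋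
  ≟-sym i j with i ≟ j | j ≟ i
  ... | yes _ | yes _ = refl
  ... | no _  | no _  = refl
  ... | yes p | no q  = Data.Empty.⊥-elim (q (sym p))
    where import Data.Empty
  ... | no p  | yes q = Data.Empty.⊥-elim (p (sym q))
    where import Data.Empty

  ≟-refl : ∀ {n} (i : Fin n) → ⌊ i ≟ i ⌋ ≡ true
  ≟-refl i with i ≟ i
  ... | yes _ = refl
  ... | no q  = Data.Empty.⊥-elim (q refl)
    where import Data.Empty

symClosure : (m : ℕ) → (Fin m → Fin m → Bool) → Graph
symClosure m R = record
  { n    = m
  ; E    = λ i j → not ⌊ i ≟ j ⌋ ∧ (R i j ∨ R j i)
  ; symE = λ i j → cong₂ (λ a b → not a ∧ b) (≟-sym i j) (∨-comm (R i j) (R j i))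
  ; irr  = λ i → irrHelp i
  }
  where
  irrHelp : ∀ i → not ⌊ i ≟ i ⌋ ∧ (R i i ∨ R i i) ≡ false
  irrHelp i rewrite ≟-refl i = refl

-- H_{t,d}: K_t on vertices 0..t-1, plus vertex t adjacent to vertices 0..d-1.
H : (t d : ℕ) → Graph
H t d = symClosure (suc t) R
  where
  R : Fin (suc t) → Fin (suc t) → Bool
  R i j = ((toℕ i <ᵇ t) ∧ (toℕ j <ᵇ t)) ∨ ((toℕ i ≡ᵇ t) ∧ (toℕ j <ᵇ d))

deg : (G : Graph) → Fin (n G) → ℕ
deg G v = sum (map (λ j → if E G v j then 1 else 0) (allFin (n G)))

MinDegreeIs : Graph → ℕ → Set
MinDegreeIs G k = (Σ (Fin (n G)) λ v → deg G v ≡ k) × (∀ v → k ≤ deg G v)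

-- a red/blue colouring of the edges of F (colour of edge {i,j} is c i j,
-- only relevant on edges; symmetric so that it is a colouring of unordered pairs)
Colouring : Graph → Set
Colouring F = Σ (Fin (n F) → Fin (n F) → Bool) λ c → ∀ i j → c i j ≡ c j i

IsCopy : (G F : Graph) → (Fin (n G) → Fin (n F)) → Set
IsCopy G F f = Injective _≡_ _≡_ f × (∀ i j → E G i j ≡ true → E F (f i) (f j) ≡ true)

MonoCopy : (F Hg : Graph) → (Fin (n F) → Fin (n F) → Bool) → Bool → Set
MonoCopy F Hg c b = Σ (Fin (n Hg) → Fin (n F)) λ f →
  IsCopy Hg F f × (∀ i j → E Hg i j ≡ true → c (f i) (f j) ≡ b)

Arrows : Graph → Graph → Set
Arrows F Hg = (col : Colouring F) → Σ Bool λ b → MonoCopy F Hg (Data.Product.proj₁ col) b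
  where import Data.Product

-- G is (isomorphic to) a proper subgraph of F: G embeds into F via an injective
-- edge-preserving map which is not an isomorphism onto F (i.e. misses a vertex
-- or an edge of F).
ProperSubgraph : Graph → Graph → Set
ProperSubgraph G F = Σ (Fin (n G) → Fin (n F)) λ g →
  IsCopy G F g ×
  ¬ (Surjective _≡_ _≡_ g × (∀ i j → E F (g i) (g j) ≡ true → E G i j ≡ true))

RamseyMinimal : Graph → Graph → Set
RamseyMinimal F Hg = Arrows F Hg × (∀ G → ProperSubgraph G F → ¬ Arrows G Hg)

sIs : Graph → ℕ → Set
sIs Hg k = (Σ Graph λ F → RamseyMinimal F Hg × MinDegreeIs F k)
         × (∀ F → RamseyMinimal F Hg → ∀ v → k ≤ deg F v)

{-# OPTIONS --safe #-}
-- Lower bound: let v have degree less than d² in a minimal F, and colour F − v without a monochromatic H. Choose greedily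
-- disjoint red K_d in the neighbourhood of v; there are fewer than d. Colour the edges from v to them blue and the other
-- edges at v red. Every vertex of H has a K_d in its neighbourhood, so a monochromatic H through v needs a red K_d
-- missing the chosen ones, or a blue K_d inside them, two vertices of which lie in a common red K_d.
--
-- Upper bound: it suffices to find a graph Q with an H-free colouring such that attaching a vertex to every d² vertices
-- of Q gives a graph F → H, because a minimal subgraph of F then contains one of the new vertices. Every H-free colouring
-- of Q shall contain, up to swapping the colours, a core of d × d vertices whose rows lie in red K_t's and whose
-- transversals lie in blue K_t's: the edges from a new vertex to the core are red on some row or blue on some transversal.
-- Each of these core edges is forced by a gadget, a copy of H minus an edge in the opposite colour. These contain no K_t,
-- so the partite construction (Hales–Jewett and Ramsey) produces Q in which the gadgets can be made monochromatic, while
-- different copies of the pattern overlap so little that no monochromatic H arises in the intended colouring.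
module Submission where

open import Defs
open import Data.Bool using (Bool; true; false; not; _∧_; _∨_; if_then_else_) renaming (T to True)
import Data.Bool.Properties as Boolₚ
open import Data.Empty using (⊥; ⊥-elim)
open import Data.Fin using (Fin; zero; suc; toℕ; _≟_; punchIn; punchOut)
import Data.Fin as Fin
import Data.Fin.Properties as Finₚ
open import Data.Fin.Relation.Unary.Top using (view; ‵fromℕ; ‵inj₁)
open import Data.List using (List; []; _∷_; length; filter; allFin; cartesianProduct)
import Data.List as List
import Data.List.Properties as Listₚ
open import Data.List.Membership.Propositional using (_∈_)
import Data.List.Membership.Propositional.Properties as ∈ₚ
open import Data.List.Relation.Unary.All using (All)
import Data.List.Relation.Unary.All as All
import Data.List.Relation.Unary.All.Properties as Allₚ
open import Data.List.Relation.Unary.AllPairs using (AllPairs; []; _∷_)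
import Data.List.Relation.Unary.AllPairs as AllPairs
import Data.List.Relation.Unary.AllPairs.Properties as AllPairsₚ
import Data.List.Relation.Unary.Any as Any
import Data.List.Relation.Unary.Any.Properties as Anyₚ
open import Data.List.Relation.Unary.Unique.Propositional using (Unique)
import Data.List.Relation.Unary.Unique.Propositional.Properties as Uniqueₚ
open import Data.Maybe using (Maybe; just; nothing; fromMaybe)
import Data.Maybe as Maybe
import Data.Maybe.Properties as Maybeₚ
open import Data.Nat using (ℕ; zero; suc; _+_; _*_; _≤_; _<_; z≤n; s≤s; _≤?_; _<ᵇ_; _≡ᵇ_)
open import Data.Nat.ListAction using (sum)
import Data.Nat.Properties as ℕₚ
open import Data.Product using (Σ; ∃; _×_; _,_; proj₁; proj₂)
open import Data.Product.Function.NonDependent.Propositional using (_×-↔_)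
open import Data.Sum using (_⊎_; inj₁; inj₂; [_,_]′)
import Data.Sum as Sum
open import Data.Sum.Properties using (inj₁-injective)
open import Data.Sum.Function.Propositional using (_⊎-↔_)
open import Data.Unit using (⊤; tt)
open import Data.Vec using (Vec; []; _∷_)
import Data.Vec as Vec
import Data.Vec.Properties as Vecₚ
open import Data.Vec.Membership.Propositional using () renaming (_∈_ to _∈ᵥ_)
import Data.Vec.Membership.Propositional.Properties as ∈ᵥₚ
open import Data.Vec.Relation.Unary.All as VAll using ([]; _∷_)
open import Data.Vec.Relation.Unary.Any using (here; there)
import Data.Vec.Relation.Unary.Any as VAny
open import Function using (_∘_; id; _↔_; mk↔ₛ′; Inverse)
open import Function.Bundles using (Equivalence)
open import Function.Construct.Composition using (_↔-∘_)
open import Function.Construct.Identity using (↔-id)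
open import Function.Construct.Symmetry using (↔-sym)
open import Relation.Binary.Definitions using (DecidableEquality; Tri; tri<; tri≈; tri>)
open import Relation.Binary.PropositionalEquality using (_≡_; _≢_; refl; sym; trans; cong; cong₂; subst; subst₂; module ≡-Reasoning)
open import Relation.Nullary using (¬_; Dec; yes; no)
open import Relation.Nullary.Decidable using (map′; _×-dec_; _⊎-dec_; _→-dec_; ¬?; does; ⌊_⌋; dec-true)

-- The gadgets call for a Ramsey property of Q, but overlapping copies of the pattern might create a
-- monochromatic H in the intended colouring. The remedy is to mark the gadget edges as active and
-- to carry an invariant through every amalgamation: no monochromatic `K_t` contains an active edge.
-- Copies share vertices in at most two parts, while a `K_t` occupies at least three, so it lies
-- inside one copy; an apex outside that copy would have two neighbours in the `K_t` that span an
-- active edge. The two neighbours come from d > 1; the third part, and room for the apex of a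
-- gadget, come from d < t. In an H-free colouring the gadgets receive colours that depend only on
-- their intended colours. These two colours must differ, since a skeleton in a single colour
-- contains H; this is why the core appears only up to swapping. Each transversal has extra vertices
-- of its own so that a blue `K_t` determines its transversal.

-- Finite types and exhaustive search

record Finite (A : Set) : Set where
  field
    size  : ℕ
    index : A ↔ Fin size

  to : A → Fin size
  to = Inverse.to index

  from : Fin size → A
  from = Inverse.from index

  to∘from : ∀ i → to (from i) ≡ i
  to∘from = Inverse.strictlyInverseˡ index

  from∘to : ∀ x → from (to x) ≡ x
  from∘to = Inverse.strictlyInverseʳ index

  to-injective : ∀ {x y} → to x ≡ to y → x ≡ y
  to-injective {x} {y} eq = trans (sym (from∘to x)) (trans (cong from eq) (from∘to y))

  from-injective : ∀ {i j} → from i ≡ from j → i ≡ j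
  from-injective {i} {j} eq = trans (sym (to∘from i)) (trans (cong to eq) (to∘from j))

  _≟′_ : DecidableEquality A
  x ≟′ y = map′ to-injective (cong to) (to x ≟ to y)

  any? : {P : A → Set} → (∀ x → Dec (P x)) → Dec (∃ P)
  any? {P} P? = map′ (λ (i , p) → from i , p) (λ (x , p) → to x , subst P (sym (from∘to x)) p)
                     (Finₚ.any? (P? ∘ from))

fin-Fin : ∀ {n} → Finite (Fin n)
fin-Fin = record { index = ↔-id _ }

fin-↔ : ∀ {A B : Set} → A ↔ B → Finite B → Finite A
fin-↔ A↔B fB = record { index = Finite.index fB ↔-∘ A↔B }

opaque
  fin-⊎ : ∀ {A B : Set} → Finite A → Finite B → Finite (A ⊎ B)
  fin-⊎ fA fB = fin-↔ (Finite.index fA ⊎-↔ Finite.index fB) (record { index = ↔-sym Finₚ.+↔⊎ })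

  fin-× : ∀ {A B : Set} → Finite A → Finite B → Finite (A × B)
  fin-× fA fB = fin-↔ (Finite.index fA ×-↔ Finite.index fB) (record { index = ↔-sym Finₚ.*↔× })

  fin-Bool : Finite Bool
  fin-Bool = fin-↔
    (mk↔ₛ′ (λ { true → inj₁ zero ; false → inj₂ zero }) (λ { (inj₁ _) → true ; (inj₂ _) → false })
           (λ { (inj₁ zero) → refl ; (inj₂ zero) → refl }) (λ { true → refl ; false → refl }))
    (fin-⊎ (fin-Fin {1}) (fin-Fin {1}))

  fin-Maybe : ∀ {A : Set} → Finite A → Finite (Maybe A)
  fin-Maybe fA = fin-↔
    (mk↔ₛ′ (λ { nothing → inj₁ zero ; (just x) → inj₂ x }) (λ { (inj₁ _) → nothing ; (inj₂ x) → just x })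
           (λ { (inj₁ zero) → refl ; (inj₂ _) → refl }) (λ { nothing → refl ; (just _) → refl }))
    (fin-⊎ (fin-Fin {1}) fA)

  fin-Vec : ∀ {A : Set} → Finite A → ∀ n → Finite (Vec A n)
  fin-Vec fA zero = fin-↔
    (mk↔ₛ′ (λ _ → zero) (λ _ → []) (λ { zero → refl }) (λ { [] → refl }))
    (fin-Fin {1})
  fin-Vec fA (suc n) = fin-↔
    (mk↔ₛ′ (λ { (x ∷ xs) → x , xs }) (λ (x , xs) → x ∷ xs) (λ _ → refl) (λ { (_ ∷ _) → refl }))
    (fin-× fA (fin-Vec fA n))

-- Functions out of Fin n are searched through their tables, so the predicate must not see more than the values.
anyFun? : ∀ {A : Set} → Finite A → ∀ {n} {P : (Fin n → A) → Set} →
          (∀ {f g} → (∀ i → f i ≡ g i) → P f → P g) → (∀ f → Dec (P f)) → Dec (∃ P)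
anyFun? fA {n} resp P? =
  map′ (λ (v , p) → Vec.lookup v , p)
       (λ (f , p) → Vec.tabulate f , resp (λ i → sym (Vecₚ.lookup∘tabulate f i)) p)
       (Finite.any? (fin-Vec fA n) (λ v → P? (Vec.lookup v)))

inj⇒size≤ : ∀ {A B : Set} (fA : Finite A) (fB : Finite B) (f : A → B) → (∀ {x y} → f x ≡ f y → x ≡ y) →
            Finite.size fA ≤ Finite.size fB
inj⇒size≤ fA fB f inj = Finₚ.injective⇒≤ {f = to fB ∘ f ∘ from fA} (from-injective fA ∘ inj ∘ to-injective fB)
  where open Finite

-- The Hales–Jewett theorem

-- A combinatorial line is a word with letters from Maybe A, in which nothing marks the moving coordinates.
fill : ∀ {A : Set} {n} → A → Vec (Maybe A) n → Vec A n
fill a = Vec.map (fromMaybe a)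

fill-++ : ∀ {A : Set} {k n} (a : A) (K : Vec (Maybe A) k) (L : Vec (Maybe A) n) →
          fill a (K Vec.++ L) ≡ fill a K Vec.++ fill a L
fill-++ a = Vecₚ.map-++ (fromMaybe a)

fill-const : ∀ {A : Set} {n} (a : A) (w : Vec A n) → fill a (Vec.map just w) ≡ w
fill-const a w = trans (sym (Vecₚ.map-∘ (fromMaybe a) just w)) (Vecₚ.map-id w)

record MonoLine {A C : Set} {n} (χ : Vec A n → C) : Set where
  field
    line   : Vec (Maybe A) n
    moving : nothing ∈ᵥ line
    mono   : ∀ a b → χ (fill a line) ≡ χ (fill b line)

-- Lines through a common point whose points with nonzero letters are monochromatic, in distinct colours.
record Focused {m n : ℕ} {C : Set} (χ : Vec (Fin (suc m)) n → C) (s : ℕ) : Set where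
  field
    focus     : Vec (Fin (suc m)) n
    line      : Fin s → Vec (Maybe (Fin (suc m))) n
    moving    : ∀ i → nothing ∈ᵥ line i
    atFocus   : ∀ i → fill zero (line i) ≡ focus
    colour    : Fin s → C
    coloured  : ∀ i a → χ (fill (suc a) (line i)) ≡ colour i
    distinct  : ∀ {i j} → colour i ≡ colour j → i ≡ j

HasMonoLines : ℕ → Set₁
HasMonoLines m = ∀ {C} → Finite C → Σ ℕ λ n → (χ : Vec (Fin m) n → C) → MonoLine χ

sucLine : ∀ {m n} → Vec (Maybe (Fin m)) n → Vec (Maybe (Fin (suc m))) n
sucLine = Vec.map (Maybe.map suc)

fill-sucLine : ∀ {m n} (a : Fin m) (L : Vec (Maybe (Fin m)) n) → fill (suc a) (sucLine L) ≡ Vec.map suc (fill a L)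
fill-sucLine a []             = refl
fill-sucLine a (just _ ∷ L)   = cong (_ ∷_) (fill-sucLine a L)
fill-sucLine a (nothing ∷ L)  = cong (_ ∷_) (fill-sucLine a L)

module AddLetter (m : ℕ) (HJ : HasMonoLines (suc m)) {C : Set} (fC : Finite C) where

  -- Colour focusing: a line for suc m letters in the prefix makes χ independent of the nonzero prefix letter,
  -- so each focused line of the induced colouring of suffixes extends, and their focus yields one more.
  focusing : ∀ s → Σ ℕ λ n → (χ : Vec (Fin (suc (suc m))) n → C) → MonoLine χ ⊎ Focused χ s
  focusing zero = 0 , λ χ → inj₂ (record
    { focus = [] ; line = λ () ; moving = λ () ; atFocus = λ () ; colour = λ () ; coloured = λ () ; distinct = λ { {()} } })
  focusing (suc s) with focusing s
  ... | n , ih = proj₁ hj + n , λ χ → extend χ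
    where
    Word : Set
    Word = Vec (Fin (suc (suc m))) n
    open Finite (fin-Vec (fin-Fin {suc (suc m)}) n) using (size; to; from; from∘to)
    hj = HJ (fin-Vec fC size)

    extend : (χ : Vec (Fin (suc (suc m))) (proj₁ hj + n) → C) → MonoLine χ ⊎ Focused χ (suc s)
    extend χ = [ inj₁ ∘ oldMono , newFocus ]′ (ih χ′)
      where
      table : Vec (Fin (suc m)) (proj₁ hj) → Vec C size
      table u = Vec.tabulate (λ i → χ (Vec.map suc u Vec.++ from i))
      prefix = proj₂ hj table
      open MonoLine prefix using () renaming (line to K₀; moving to moving₀; mono to mono₀)
      K = sucLine K₀
      movingK : nothing ∈ᵥ K
      movingK = ∈ᵥₚ.∈-map⁺ _ moving₀

      χ′ : Word → C
      χ′ w = χ (fill (suc zero) K Vec.++ w)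

      table-lookup : ∀ a w → Vec.lookup (table (fill a K₀)) (to w) ≡ χ (fill (suc a) K Vec.++ w)
      table-lookup a w = trans (Vecₚ.lookup∘tabulate _ (to w))
        (cong₂ (λ u v → χ (u Vec.++ v)) (sym (fill-sucLine a K₀)) (from∘to w))

      anyLetter : ∀ a w → χ (fill (suc a) K Vec.++ w) ≡ χ′ w
      anyLetter a w = trans (sym (table-lookup a w))
        (trans (cong (λ t → Vec.lookup t (to w)) (mono₀ a zero)) (table-lookup zero w))

      oldMono : MonoLine χ′ → MonoLine χ
      oldMono l = record
        { line   = Vec.map just pre Vec.++ line
        ; moving = ∈ᵥₚ.∈-++⁺ʳ (Vec.map just pre) moving
        ; mono   = λ a b → trans (cong χ (shape a)) (trans (mono a b) (sym (cong χ (shape b)))) }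
        where
        open MonoLine l
        pre = fill (suc zero) K
        shape : ∀ a → fill a (Vec.map just pre Vec.++ line) ≡ pre Vec.++ fill a line
        shape a = trans (fill-++ a (Vec.map just pre) line) (cong (Vec._++ fill a line) (fill-const a pre))

      newFocus : Focused χ′ s → MonoLine χ ⊎ Focused χ (suc s)
      newFocus f with Finₚ.any? (λ i → Finite._≟′_ fC (Focused.colour f i) (χ′ (Focused.focus f)))
      ... | yes (i , eq) = inj₁ (oldMono (record
            { line = line i ; moving = moving i ; mono = λ a b → trans (value a) (sym (value b)) }))
        where
        open Focused f
        value : ∀ a → χ′ (fill a (line i)) ≡ colour i
        value zero    = trans (cong χ′ (atFocus i)) (sym eq)
        value (suc a) = coloured i a
      ... | no new = inj₂ (record
            { focus    = fill zero K Vec.++ focus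
            ; line     = line⁺
            ; moving   = λ { zero → ∈ᵥₚ.∈-++⁺ˡ movingK ; (suc i) → ∈ᵥₚ.∈-++⁺ˡ movingK }
            ; atFocus  = λ { zero    → trans (fill-++ zero K _) (cong (fill zero K Vec.++_) (fill-const zero focus))
                           ; (suc i) → trans (fill-++ zero K _) (cong (fill zero K Vec.++_) (atFocus i)) }
            ; colour   = colour⁺
            ; coloured = λ { zero a    → trans (cong χ (trans (fill-++ (suc a) K _)
                                                  (cong (fill (suc a) K Vec.++_) (fill-const (suc a) focus))))
                                               (anyLetter a focus)
                           ; (suc i) a → trans (cong χ (fill-++ (suc a) K _)) (trans (anyLetter a _) (coloured i a)) }
            ; distinct = distinct⁺ _ _ })
        where
        open Focused f
        line⁺ : Fin (suc s) → _
        -- The new line moves in the prefix only, the old ones in prefix and suffix at once; with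
        -- letter zero all of them pass through `fill zero K` followed by the old focus.
        line⁺ zero    = K Vec.++ Vec.map just focus
        line⁺ (suc i) = K Vec.++ line i
        colour⁺ : Fin (suc s) → C
        colour⁺ zero    = χ′ focus
        colour⁺ (suc i) = colour i
        distinct⁺ : ∀ i j → colour⁺ i ≡ colour⁺ j → i ≡ j
        distinct⁺ zero    zero    _  = refl
        distinct⁺ zero    (suc j) eq = ⊥-elim (new (j , sym eq))
        distinct⁺ (suc i) zero    eq = ⊥-elim (new (i , eq))
        distinct⁺ (suc i) (suc j) eq = cong suc (distinct eq)

opaque
  halesJewett : ∀ m → HasMonoLines m
  halesJewett zero fC = 1 , λ χ → record { line = nothing ∷ [] ; moving = here refl ; mono = λ () }
  halesJewett (suc zero) fC = 1 , λ χ → record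
    { line = nothing ∷ [] ; moving = here refl ; mono = λ { zero zero → refl } }
  -- Focused lines have distinct colours, so asking for one more than there are colours leaves only
  -- the monochromatic line.
  halesJewett (suc (suc m)) {C} fC with AddLetter.focusing m (halesJewett (suc m)) fC (suc (Finite.size fC))
  ... | n , h = n , λ χ → [ id , ⊥-elim ∘ tooMany χ ]′ (h χ)
    where
    tooMany : (χ : Vec (Fin (suc (suc m))) n → C) → ¬ Focused χ (suc (Finite.size fC))
    tooMany χ f = ℕₚ.1+n≰n (inj⇒size≤ fin-Fin fC (Focused.colour f) (Focused.distinct f))

-- Ramsey's theorem for pairs

-- P is a pairwise property of xs inherited by the list, which lets Ramsey's theorem be applied to it again.
record Homogeneous {A : Set} (P : A → A → Set) (f : A → A → Bool) (c : Bool) (p : ℕ) (xs : List A) : Set where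
  field
    list   : List A
    sub    : ∀ {y} → y ∈ list → y ∈ xs
    long   : p ≤ length list
    kept   : AllPairs P list
    homog  : AllPairs (λ x y → f x y ≡ c) list

module _ {A : Set} {P : A → A → Set} {f : A → A → Bool} where

  shortHomog : ∀ {c xs} → Homogeneous P f c 0 xs
  shortHomog = record { list = [] ; sub = λ () ; long = z≤n ; kept = [] ; homog = [] }

  weakenHomog : ∀ {c p xs ys} → (∀ {y} → y ∈ ys → y ∈ xs) → Homogeneous P f c p ys → Homogeneous P f c p xs
  weakenHomog ys⊆xs h = record { Homogeneous h ; sub = ys⊆xs ∘ Homogeneous.sub h }

  consHomog : ∀ {c p x xs ys} → All (P x) xs → All (λ y → f x y ≡ c) ys → (∀ {y} → y ∈ ys → y ∈ xs) →
              Homogeneous P f c p ys → Homogeneous P f c (suc p) (x ∷ xs)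
  consHomog {x = x} Px fx ys⊆xs h = record
    { list  = x ∷ list
    ; sub   = λ { (Any.here refl) → Any.here refl ; (Any.there y∈) → Any.there (ys⊆xs (sub y∈)) }
    ; long  = s≤s long
    ; kept  = All.tabulate (λ y∈ → All.lookup Px (ys⊆xs (sub y∈))) ∷ kept
    ; homog = All.tabulate (λ y∈ → All.lookup fx (sub y∈)) ∷ homog }
    where open Homogeneous h

filter-split : ∀ {A : Set} (g : A → Bool) xs →
  length (filter (λ y → g y Boolₚ.≟ true) xs) + length (filter (λ y → g y Boolₚ.≟ false) xs) ≡ length xs
filter-split g [] = refl
filter-split g (x ∷ xs) with g x
... | true  = cong suc (filter-split g xs)
... | false = trans (ℕₚ.+-suc _ _) (cong suc (filter-split g xs))

ramseyNumber : ℕ → ℕ → ℕ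
ramseyNumber zero    q       = 0
ramseyNumber (suc p) zero    = 0
ramseyNumber (suc p) (suc q) = suc (ramseyNumber p (suc q) + ramseyNumber (suc p) q)

ramsey : ∀ p q {A : Set} {P : A → A → Set} (f : A → A → Bool) xs → AllPairs P xs → ramseyNumber p q ≤ length xs →
         Homogeneous P f true p xs ⊎ Homogeneous P f false q xs
ramsey zero    q       f xs _ _ = inj₁ shortHomog
ramsey (suc p) zero    f xs _ _ = inj₂ shortHomog
ramsey (suc p) (suc q) f (x ∷ xs) (Px ∷ Pxs) (s≤s long) = split (ℕₚ.<-≤-connex (length ts) (ramseyNumber p (suc q)))
  where
  keep : ∀ c → List _
  keep c = filter (λ y → f x y Boolₚ.≟ c) xs
  ts = keep true
  fs = keep false
  sub : ∀ c {y} → y ∈ keep c → y ∈ xs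
  sub c = proj₁ ∘ ∈ₚ.∈-filter⁻ (λ y → f x y Boolₚ.≟ c)
  pairs : ∀ c → AllPairs _ (keep c)
  pairs c = AllPairsₚ.filter⁺ (λ y → f x y Boolₚ.≟ c) Pxs
  cons : ∀ c {r} → Homogeneous _ f c r (keep c) → Homogeneous _ f c (suc r) (x ∷ xs)
  cons c = consHomog Px (Allₚ.all-filter (λ y → f x y Boolₚ.≟ c) xs) (sub c)
  total : length ts + length fs ≡ length xs
  total = filter-split (f x) xs
  split : _ → _
  split (inj₂ big) = [ inj₁ ∘ cons true , inj₂ ∘ weakenHomog (Any.there ∘ sub true) ]′
    (ramsey p (suc q) f ts (pairs true) big)
  split (inj₁ small) = [ inj₁ ∘ weakenHomog (Any.there ∘ sub false) , inj₂ ∘ cons false ]′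
    (ramsey (suc p) q f fs (pairs false)
      (ℕₚ.+-cancelˡ-≤ (ramseyNumber p (suc q)) _ _ (ℕₚ.≤-trans (subst (_ ≤_) (sym total) long)
        (ℕₚ.+-monoˡ-≤ (length fs) (ℕₚ.<⇒≤ small)))))

AllPairs-lookup : ∀ {A : Set} {P : A → A → Set} {xs} → AllPairs P xs → ∀ {i j} → i Fin.< j →
                  P (List.lookup xs i) (List.lookup xs j)
AllPairs-lookup {xs = x ∷ xs} (Px ∷ Pxs) {zero}  {suc j} _         = All.lookup Px (∈ₚ.∈-lookup j)
AllPairs-lookup {xs = x ∷ xs} (Px ∷ Pxs) {suc i} {suc j} (s≤s i<j) = AllPairs-lookup Pxs i<j

ramsey₂Number : ℕ → ℕ
ramsey₂Number p = let r = ramseyNumber p p in ramseyNumber r r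

-- The colourings are treated in turn: the first application keeps `ramseyNumber p p` elements,
-- enough for the second, and `kept` hands on both distinctness and the first homogeneity. Only
-- increasing pairs are controlled, as `f` need not be symmetric.
ramsey₂ : ∀ p (f : Bool → Fin (ramsey₂Number p) → Fin (ramsey₂Number p) → Bool) →
          Σ (Fin p → Fin (ramsey₂Number p)) λ s → Σ (Bool → Bool) λ γ →
            ∀ {i j} → i Fin.< j → s i ≢ s j × (∀ b → f b (s i) (s j) ≡ γ b)
ramsey₂ p f = s , γ , s-homog
  where
  all = allFin (ramsey₂Number p)

  merge : ∀ {A : Set} {P : A → A → Set} {g r xs} → Homogeneous P g true r xs ⊎ Homogeneous P g false r xs →
          Σ Bool λ c → Homogeneous P g c r xs
  merge = [ true ,_ , false ,_ ]′

  first = merge (ramsey (ramseyNumber p p) (ramseyNumber p p) (f true) all (Uniqueₚ.allFin⁺ _)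
                        (ℕₚ.≤-reflexive (sym (Listₚ.length-tabulate id))))
  module H₁ = Homogeneous (proj₂ first)
  second = merge (ramsey p p (f false) H₁.list (AllPairs.zip (H₁.kept , H₁.homog)) H₁.long)
  module H₂ = Homogeneous (proj₂ second)

  s : Fin p → Fin _
  s i = List.lookup H₂.list (Fin.inject≤ i H₂.long)

  γ : Bool → Bool
  γ true  = proj₁ first
  γ false = proj₁ second

  s-homog : ∀ {i j} → i Fin.< j → s i ≢ s j × (∀ b → f b (s i) (s j) ≡ γ b)
  s-homog i<j = proj₁ (proj₁ pair) , λ { true → proj₂ (proj₁ pair) ; false → proj₂ pair }
    where
    pair = AllPairs-lookup (AllPairs.zip (H₂.kept , H₂.homog))
             (subst₂ _<_ (sym (Finₚ.toℕ-inject≤ _ H₂.long)) (sym (Finₚ.toℕ-inject≤ _ H₂.long)) i<j)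

-- Graphs, and minimal Ramsey subgraphs

Unique-lookup : ∀ {A : Set} {xs : List A} → Unique xs → ∀ i j → List.lookup xs i ≡ List.lookup xs j → i ≡ j
Unique-lookup {xs = _ ∷ _} (_  ∷ _) zero    zero    _  = refl
Unique-lookup {xs = _ ∷ _} (x∉ ∷ _) zero    (suc j) eq = ⊥-elim (All.lookup x∉ (∈ₚ.∈-lookup j) eq)
Unique-lookup {xs = _ ∷ _} (x∉ ∷ _) (suc i) zero    eq = ⊥-elim (All.lookup x∉ (∈ₚ.∈-lookup i) (sym eq))
Unique-lookup {xs = _ ∷ _} (_  ∷ u) (suc i) (suc j) eq = cong suc (Unique-lookup u i j eq)

-- An injection into `Fin k` presented as a relation, so that codes are required only of members of
-- the list. It serves for list inclusions and for the degree of a new vertex.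
coded-length : ∀ {A : Set} {k} (Code : A → Fin k → Set) {xs} → Unique xs → (∀ {x} → x ∈ xs → ∃ (Code x)) →
               (∀ {x y c} → Code x c → Code y c → x ≡ y) → length xs ≤ k
coded-length Code {xs} unique code decode = Finₚ.injective⇒≤ {f = λ i → proj₁ (code (∈ₚ.∈-lookup {xs = xs} i))}
  (λ {i} {j} eq → Unique-lookup unique i j (decode (proj₂ (code (∈ₚ.∈-lookup i)))
    (subst (Code _) (sym eq) (proj₂ (code (∈ₚ.∈-lookup j))))))

Unique-⊆-length : ∀ {A : Set} {xs ys : List A} → Unique xs → (∀ {x} → x ∈ xs → x ∈ ys) → length xs ≤ length ys
Unique-⊆-length {ys = ys} unique xs⊆ys = coded-length (λ x i → x ≡ List.lookup ys i) unique
  (λ x∈ → Any.index (xs⊆ys x∈) , Anyₚ.lookup-index (xs⊆ys x∈)) (λ eq eq′ → trans eq (sym eq′))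

neighbours : (G : Graph) → Fin (n G) → List (Fin (n G))
neighbours G v = filter (λ j → E G v j Boolₚ.≟ true) (allFin (n G))

deg-neighbours : ∀ G v → deg G v ≡ length (neighbours G v)
deg-neighbours G v = count (allFin (n G))
  where
  count : ∀ xs → sum (List.map (λ j → if E G v j then 1 else 0) xs) ≡ length (filter (λ j → E G v j Boolₚ.≟ true) xs)
  count [] = refl
  count (x ∷ xs) with E G v x
  ... | true  = cong suc (count xs)
  ... | false = count xs

neighbours-unique : ∀ G v → Unique (neighbours G v)
neighbours-unique G v = Uniqueₚ.filter⁺ (λ j → E G v j Boolₚ.≟ true) (Uniqueₚ.allFin⁺ (n G))

∈-neighbours : ∀ G v {j} → E G v j ≡ true → j ∈ neighbours G v
∈-neighbours G v = ∈ₚ.∈-filter⁺ (λ j → E G v j Boolₚ.≟ true) (∈ₚ.∈-allFin _)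

neighbours-adjacent : ∀ G v {j} → j ∈ neighbours G v → E G v j ≡ true
neighbours-adjacent G v j∈ = proj₂ (∈ₚ.∈-filter⁻ (λ j → E G v j Boolₚ.≟ true) {xs = allFin (n G)} j∈)

isCopy? : ∀ G F f → Dec (IsCopy G F f)
isCopy? G F f = map′ (λ h {x} {y} → h x y) (λ h x y → h)
                  (Finₚ.all? λ x → Finₚ.all? λ y → (f x ≟ f y) →-dec (x ≟ y))
          ×-dec (Finₚ.all? λ i → Finₚ.all? λ j → (E G i j Boolₚ.≟ true) →-dec (E F (f i) (f j) Boolₚ.≟ true))

isCopy-resp : ∀ {G F f g} → (∀ i → f i ≡ g i) → IsCopy G F f → IsCopy G F g
isCopy-resp {F = F} f≗g (inj , edge) = (λ eq → inj (trans (f≗g _) (trans eq (sym (f≗g _))))) ,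
  λ i j Eij → subst₂ (λ u w → E F u w ≡ true) (f≗g i) (f≗g j) (edge i j Eij)

isCopy-∘ : ∀ {G F K f g} → IsCopy F K g → IsCopy G F f → IsCopy G K (g ∘ f)
isCopy-∘ (injg , edgeg) (injf , edgef) = injf ∘ injg , λ i j Eij → edgeg _ _ (edgef i j Eij)

monoCopy? : ∀ F Hg c b → Dec (MonoCopy F Hg c b)
monoCopy? F Hg c b = anyFun? fin-Fin
  (λ {f} {g} f≗g (copy , mono) → isCopy-resp {Hg} {F} f≗g copy ,
     λ i j Eij → subst₂ (λ u w → c u w ≡ b) (f≗g i) (f≗g j) (mono i j Eij))
  (λ f → isCopy? Hg F f ×-dec
     (Finₚ.all? λ i → Finₚ.all? λ j → (E Hg i j Boolₚ.≟ true) →-dec (c (f i) (f j) Boolₚ.≟ b)))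

someMonoCopy? : ∀ F Hg c → Dec (∃ (MonoCopy F Hg c))
someMonoCopy? F Hg c = Finite.any? fin-Bool (monoCopy? F Hg c)

monoCopy-resp : ∀ {F Hg c c′} → (∀ i j → c i j ≡ c′ i j) → ∃ (MonoCopy F Hg c) → ∃ (MonoCopy F Hg c′)
monoCopy-resp c≗c′ (b , f , copy , mono) = b , f , copy , λ i j Eij → trans (sym (c≗c′ _ _)) (mono i j Eij)

-- The search runs over tables of colourings. If no table is bad, the decidability of monochromatic
-- copies turns the absence of a counterexample into an actual copy.
arrows? : ∀ F Hg → Dec (Arrows F Hg)
arrows? F Hg with Finite.any? (fin-Vec (fin-Vec fin-Bool (n F)) (n F)) (λ w →
    (Finₚ.all? λ i → Finₚ.all? λ j → at w i j Boolₚ.≟ at w j i) ×-dec ¬? (someMonoCopy? F Hg (at w)))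
  where
  at : Vec (Vec Bool (n F)) (n F) → Fin (n F) → Fin (n F) → Bool
  at w i j = Vec.lookup (Vec.lookup w i) j
... | yes (w , symmetric , none) = no λ arr → none (arr (_ , symmetric))
... | no no-bad = yes λ (c , c-sym) → decide c c-sym
  where
  decide : ∀ c → (∀ i j → c i j ≡ c j i) → ∃ (MonoCopy F Hg c)
  decide c c-sym with someMonoCopy? F Hg c
  ... | yes found = found
  ... | no none   = ⊥-elim (no-bad (table , symmetric , none ∘ monoCopy-resp {F} {Hg} at-table))
    where
    table : Vec (Vec Bool (n F)) (n F)
    table = Vec.tabulate λ i → Vec.tabulate (c i)
    at-table : ∀ i j → Vec.lookup (Vec.lookup table i) j ≡ c i j
    at-table i j = trans (cong (λ r → Vec.lookup r j) (Vecₚ.lookup∘tabulate _ i)) (Vecₚ.lookup∘tabulate (c i) j)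
    symmetric : ∀ i j → Vec.lookup (Vec.lookup table i) j ≡ Vec.lookup (Vec.lookup table j) i
    symmetric i j = trans (at-table i j) (trans (c-sym i j) (sym (at-table j i)))

Arrows-mono : ∀ {G F Hg g} → IsCopy G F g → Arrows G Hg → Arrows F Hg
Arrows-mono {G} {F} {Hg} {g} copy arr (c , c-sym) with arr ((λ i j → c (g i) (g j)) , λ i j → c-sym _ _)
... | b , f , copyf , mono = b , g ∘ f , isCopy-∘ {Hg} {G} {F} copy copyf , mono

delVertex : (F : Graph) → Fin (n F) → Graph
delVertex record { n = suc m ; E = E ; symE = symE ; irr = irr } v = record
  { n = m ; E = λ i j → E (punchIn v i) (punchIn v j) ; symE = λ i j → symE _ _ ; irr = λ i → irr _ }

inclusion : ∀ F v → Fin (n (delVertex F v)) → Fin (n F)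
inclusion record { n = suc m } v = punchIn v

inclusion-copy : ∀ F v → IsCopy (delVertex F v) F (inclusion F v)
inclusion-copy record { n = suc m } v = Finₚ.punchIn-injective v _ _ , λ i j Eij → Eij

inclusion-induced : ∀ F v i j → E F (inclusion F v i) (inclusion F v j) ≡ E (delVertex F v) i j
inclusion-induced record { n = suc m } v i j = refl

inclusion-avoids : ∀ F v i → inclusion F v i ≢ v
inclusion-avoids record { n = suc m } v i = Finₚ.punchInᵢ≢i v i

inclusion-onto : ∀ F v {j} → v ≢ j → ∃ λ i → inclusion F v i ≡ j
inclusion-onto record { n = suc m } v v≢j = punchOut v≢j , Finₚ.punchIn-punchOut v≢j

delVertex-size : ∀ F v → n F ≡ suc (n (delVertex F v))
delVertex-size record { n = suc m } v = refl

delVertex-proper : ∀ F v → ProperSubgraph (delVertex F v) F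
delVertex-proper F v = inclusion F v , inclusion-copy F v ,
  λ (surj , _) → inclusion-avoids F v (proj₁ (surj v)) (proj₂ (surj v) refl)

module DelEdge (F : Graph) (i j : Fin (n F)) where

  Same : Fin (n F) → Fin (n F) → Set
  Same x y = (x ≡ i × y ≡ j) ⊎ (x ≡ j × y ≡ i)

  same? : ∀ x y → Dec (Same x y)
  same? x y = ((x ≟ i) ×-dec (y ≟ j)) ⊎-dec ((x ≟ j) ×-dec (y ≟ i))

  same-sym : ∀ {x y} → Same x y → Same y x
  same-sym (inj₁ (x≡ , y≡)) = inj₂ (y≡ , x≡)
  same-sym (inj₂ (x≡ , y≡)) = inj₁ (y≡ , x≡)

  E⁻ : Fin (n F) → Fin (n F) → Bool
  E⁻ x y with same? x y
  ... | yes _ = false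
  ... | no _  = E F x y

  E⁻-sym : ∀ x y → E⁻ x y ≡ E⁻ y x
  E⁻-sym x y with same? x y | same? y x
  ... | yes _ | yes _ = refl
  ... | no _  | no _  = symE F x y
  ... | yes s | no ¬s = ⊥-elim (¬s (same-sym s))
  ... | no ¬s | yes s = ⊥-elim (¬s (same-sym s))

  E⁻-irr : ∀ x → E⁻ x x ≡ false
  E⁻-irr x with same? x x
  ... | yes _ = refl
  ... | no _  = irr F x

  E⁻⇒E : ∀ {x y} → E⁻ x y ≡ true → E F x y ≡ true
  E⁻⇒E {x} {y} eq with same? x y
  ... | no _ = eq

  E⁻⇒¬Same : ∀ {x y} → E⁻ x y ≡ true → ¬ Same x y
  E⁻⇒¬Same {x} {y} eq with same? x y
  ... | no ¬s = ¬s

  E⇒E⁻ : ∀ {x y} → ¬ Same x y → E F x y ≡ true → E⁻ x y ≡ true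
  E⇒E⁻ {x} {y} ¬s eq with same? x y
  ... | yes s = ⊥-elim (¬s s)
  ... | no _  = eq

  delEdge : Graph
  delEdge = record { n = n F ; E = E⁻ ; symE = E⁻-sym ; irr = E⁻-irr }

  delEdge-copy : IsCopy delEdge F id
  delEdge-copy = id , λ _ _ → E⁻⇒E

open DelEdge using (delEdge; delEdge-copy)

edges : (G : Graph) → List (Fin (n G) × Fin (n G))
edges G = filter (λ (i , j) → E G i j Boolₚ.≟ true) (cartesianProduct (allFin (n G)) (allFin (n G)))

∈-edges : ∀ G {i j} → E G i j ≡ true → (i , j) ∈ edges G
∈-edges G = ∈ₚ.∈-filter⁺ (λ (i , j) → E G i j Boolₚ.≟ true) (∈ₚ.∈-cartesianProduct⁺ (∈ₚ.∈-allFin _) (∈ₚ.∈-allFin _))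

edges-adjacent : ∀ G {i j} → (i , j) ∈ edges G → E G i j ≡ true
edges-adjacent G ij∈ = proj₂ (∈ₚ.∈-filter⁻ (λ (i , j) → E G i j Boolₚ.≟ true)
  {xs = cartesianProduct (allFin (n G)) (allFin (n G))} ij∈)

edges-unique : ∀ G → Unique (edges G)
edges-unique G = Uniqueₚ.filter⁺ (λ (i , j) → E G i j Boolₚ.≟ true)
  (Uniqueₚ.cartesianProduct⁺ (Uniqueₚ.allFin⁺ _) (Uniqueₚ.allFin⁺ _))

delEdge-fewer : ∀ F i j → E F i j ≡ true → length (edges (delEdge F i j)) < length (edges F)
delEdge-fewer F i j Eij = Unique-⊆-length
  {xs = (i , j) ∷ edges (delEdge F i j)} {edges F}
  (All.tabulate (λ { {x , y} xy∈ refl → E⁻⇒¬Same (edges-adjacent (delEdge F i j) xy∈) (inj₁ (refl , refl)) })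
    ∷ edges-unique (delEdge F i j))
  (λ { (Any.here refl) → ∈-edges F Eij ; {x , y} (Any.there xy∈) → ∈-edges F (E⁻⇒E (edges-adjacent (delEdge F i j) xy∈)) })
  where open DelEdge F i j using (E⁻⇒¬Same; E⁻⇒E)

-- The embedding misses a vertex, or it is onto and then misses an edge, as otherwise it would be an
-- isomorphism. Hence minimality has to be tested only against single deletions.
subgraph-of-deletion : ∀ {G F} → ProperSubgraph G F →
  (∃ λ v → ∃ (IsCopy G (delVertex F v))) ⊎ (∃ λ i → ∃ λ j → E F i j ≡ true × ∃ (IsCopy G (delEdge F i j)))
subgraph-of-deletion {G} {F} (g , (inj , edge) , proper)
  with Finₚ.any? (λ v → Finₚ.all? (λ x → ¬? (v ≟ g x)))
... | yes (v , missed) = inj₁ (v , g′ , (λ {x} {y} eq → inj (trans (sym (at x)) (trans (cong (inclusion F v) eq) (at y)))) ,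
    λ i j Eij → trans (sym (inclusion-induced F v _ _)) (subst₂ (λ x y → E F x y ≡ true) (sym (at i)) (sym (at j)) (edge i j Eij)))
  where
  g′ : Fin (n G) → Fin (n (delVertex F v))
  g′ x = proj₁ (inclusion-onto F v (missed x))
  at : ∀ x → inclusion F v (g′ x) ≡ g x
  at x = proj₂ (inclusion-onto F v (missed x))
... | no onto with Finₚ.any? (λ x → Finₚ.any? (λ y → (E F (g x) (g y) Boolₚ.≟ true) ×-dec (E G x y Boolₚ.≟ false)))
...   | yes (x , y , Egxy , ¬Exy) = inj₂ (g x , g y , Egxy , g , inj , λ i j Eij → E⇒E⁻ (other Eij) (edge i j Eij))
  where
  open DelEdge F (g x) (g y) using (Same; E⇒E⁻)
  other : ∀ {i j} → E G i j ≡ true → ¬ Same (g i) (g j)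
  other Eij (inj₁ (i≡ , j≡)) with inj i≡ | inj j≡
  ... | refl | refl with trans (sym Eij) ¬Exy
  ...   | ()
  other Eij (inj₂ (i≡ , j≡)) with inj i≡ | inj j≡
  ... | refl | refl with trans (sym Eij) (trans (symE G _ _) ¬Exy)
  ...   | ()
...   | no induced = ⊥-elim (proper (surjective , λ i j Egij → Boolₚ.¬-not (λ ¬Eij → induced (i , j , Egij , ¬Eij))))
  where
  surjective : ∀ y → ∃ λ x → ∀ {z} → z ≡ x → g z ≡ y
  surjective y with Finₚ.any? (λ x → y ≟ g x)
  ... | yes (x , eq) = x , λ { refl → sym eq }
  ... | no none      = ⊥-elim (onto (y , λ x eq → none (x , eq)))

MinimalSubgraph : Graph → Graph → Set
MinimalSubgraph Hg F = Σ Graph λ F′ → ∃ (IsCopy F′ F) × RamseyMinimal F′ Hg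

minimal-subgraph : ∀ Hg F → Arrows F Hg → MinimalSubgraph Hg F
minimal-subgraph Hg F arr = search _ _ F (ℕₚ.n<1+n (n F)) (ℕₚ.n<1+n (length (edges F))) arr
  where
  within : ∀ {G F g} → IsCopy G F g → MinimalSubgraph Hg G → MinimalSubgraph Hg F
  within {G} {F} copy (F′ , (f , copyf) , min) = F′ , (_ , isCopy-∘ {F′} {G} {F} copy copyf) , min

  -- The bounds decrease lexicographically: deleting an edge lowers `k`; deleting a vertex lowers
  -- `m` and lets `k` start afresh.
  search : ∀ m k F → n F < m → length (edges F) < k → Arrows F Hg → MinimalSubgraph Hg F
  smaller : ∀ m F v → n F < m → Arrows (delVertex F v) Hg → MinimalSubgraph Hg F

  smaller (suc m) F v (s≤s n≤m) arr = within {delVertex F v} {F} (inclusion-copy F v)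
    (search m _ (delVertex F v) (subst (_≤ m) (delVertex-size F v) n≤m) (ℕₚ.n<1+n _) arr)

  search m (suc k) F n<m (s≤s e≤k) arr with Finₚ.any? (λ v → arrows? (delVertex F v) Hg)
  ... | yes (v , arr′) = smaller m F v n<m arr′
  ... | no none with Finₚ.any? (λ i → Finₚ.any? (λ j → (E F i j Boolₚ.≟ true) ×-dec arrows? (delEdge F i j) Hg))
  ...   | yes (i , j , Eij , arr′) = within {delEdge F i j} {F} (delEdge-copy F i j)
    (search m k (delEdge F i j) n<m (ℕₚ.<-≤-trans (delEdge-fewer F i j Eij) e≤k) arr′)
  ...   | no none′ = F , (id , id , λ _ _ → id) , arr , λ G proper arrG →
    [ (λ (v , _ , copy) → none (v , Arrows-mono {G} {delVertex F v} {Hg} copy arrG))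
    , (λ (i , j , Eij , _ , copy) → none′ (i , j , Eij , Arrows-mono {G} {delEdge F i j} {Hg} copy arrG)) ]′
    (subgraph-of-deletion {G} {F} proper)

-- H is H_{t,d} with d = 2 + d′ and t = d + e, e = 1 + e′.
module Construction (d′ e′ : ℕ) where

  -- The partite construction

  module _ {A : Set} (Good : A → Set) where

    Constant : Maybe A → Set
    Constant nothing  = ⊤
    Constant (just g) = Good g

    moving-meets : ∀ {n} {k l : Vec (Maybe A) n} {p p′} → nothing ∈ᵥ k → VAll.All Constant l →
                   fill p k ≡ fill p′ l → Good p ⊎ p ≡ p′
    moving-meets {l = nothing ∷ _} (here refl) _ eq = inj₂ (Vecₚ.∷-injectiveˡ eq)
    moving-meets {l = just _ ∷ _} (here refl) (good ∷ _) eq = inj₁ (subst Good (sym (Vecₚ.∷-injectiveˡ eq)) good)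
    moving-meets {k = _ ∷ _} {_ ∷ _} (there ★) (_ ∷ cl) eq = moving-meets ★ cl (Vecₚ.∷-injectiveʳ eq)

    lines-through : ∀ {n} {k l : Vec (Maybe A) n} {p} → VAll.All Constant k → VAll.All Constant l →
                    fill p k ≡ fill p l → Good p ⊎ k ≡ l
    lines-through {k = []} {[]} _ _ _ = inj₂ refl
    lines-through {k = k ∷ ks} {l ∷ ls} (ck ∷ cks) (cl ∷ cls) eq
      with lines-through cks cls (Vecₚ.∷-injectiveʳ eq)
    ... | inj₁ good = inj₁ good
    ... | inj₂ refl with k | l | Vecₚ.∷-injectiveˡ eq
    ...   | nothing | nothing | _    = inj₂ refl
    ...   | nothing | just _  | refl = inj₁ cl
    ...   | just _  | nothing | refl = inj₁ ck
    ...   | just _  | just _  | refl = inj₂ refl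

    -- Where one line moves, its letter equals a good constant of the other, or the other moves too
    -- and the letters agree. With equal letters, distinct lines differ at a coordinate where just
    -- one of them moves, and the constant of the other is that letter. This is what limits the
    -- overlap of two copies.
    lines-meet-in-good : ∀ {n} {k l : Vec (Maybe A) n} {p p′} → nothing ∈ᵥ k → nothing ∈ᵥ l →
      VAll.All Constant k → VAll.All Constant l → k ≢ l → fill p k ≡ fill p′ l → Good p × Good p′
    lines-meet-in-good ★k ★l ck cl k≢l eq with moving-meets ★k cl eq | moving-meets ★l ck (sym eq)
    ... | inj₁ g    | inj₁ g′   = g , g′
    ... | inj₁ g    | inj₂ refl = g , g
    ... | inj₂ refl | inj₁ g    = g , g
    ... | inj₂ refl | inj₂ _    with lines-through ck cl eq
    ...   | inj₁ g    = g , g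
    ...   | inj₂ refl = ⊥-elim (k≢l refl)

  d e : ℕ
  d = suc (suc d′)
  e = suc e′

  I : Set
  I = Fin d ⊎ Fin e

  Clique : {V : Set} → (V → V → Set) → (I → V) → Set
  Clique R κ = ∀ {i j} → i ≢ j → R (κ i) (κ j)

  -- κ is the K_t, with the neighbours of the additional vertex v indexed by inj₁.
  record HCopy {V : Set} (R : V → V → Set) : Set where
    field
      κ      : I → V
      v      : V
      clique : Clique R κ
      apex   : ∀ i → R v (κ (inj₁ i))
      fresh  : ∀ i → v ≢ κ i

  -- Edges carry a colour and a flag; only the edges with flag true ("active") are made homogeneous by the Ramsey argument.
  record System (N : ℕ) : Set₁ where
    field
      V           : Set
      finite      : Finite V
      part        : V → Fin N
      Edge        : Bool → Bool → V → V → Set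
      Edge?       : ∀ c f x y → Dec (Edge c f x y)
      Edge-sym    : ∀ {c f x y} → Edge c f x y → Edge c f y x
      Edge-part   : ∀ {c f x y} → Edge c f x y → part x ≢ part y
      Edge-unique : ∀ {c f c′ f′ x y} → Edge c f x y → Edge c′ f′ x y → c ≡ c′ × f ≡ f′

    Mono : Bool → V → V → Set
    Mono c x y = ∃ λ f → Edge c f x y

    field
      -- Copies in an amalgam may share active edges. If a `K_t` contained one, another copy could
      -- supply an apex to it; excluding this keeps `H-free` intact under amalgamation.
      clique-passive : ∀ {c κ} → Clique (Mono c) κ → ∀ i j → ¬ Edge c true (κ i) (κ j)
      H-free         : ∀ c → ¬ HCopy (Mono c)

  common-value : ∀ {m} (f : Fin m → Bool) → (∀ i j → f i ≡ f j) → ∃ λ β → ∀ i → f i ≡ β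
  -- Without letters there is no colour to read off, and any value will do.
  common-value {zero}  f _     = true , λ ()
  common-value {suc _} f const = f zero , λ i → const i zero

  -- Two neighbours of the apex, available since d > 1, and a vertex of the `K_t` outside its
  -- prescribed neighbours, available since d < t.
  i₀ i₁ i₂ : I
  i₀ = inj₁ zero
  i₁ = inj₁ (suc zero)
  i₂ = inj₂ zero

  _≟I_ : (i j : I) → Dec (i ≡ j)
  _≟I_ = Finite._≟′_ (fin-⊎ fin-Fin fin-Fin)

  module Amalgam {N : ℕ} (S : System N) (c₀ : Bool) (a b : Fin N) where
    open System S
    module FV = Finite finite

    Good : V × V → Set
    Good (x , y) = part x ≡ a × part y ≡ b × Edge c₀ true x y

    Good? : ∀ p → Dec (Good p)
    Good? (x , y) = (part x ≟ a) ×-dec (part y ≟ b) ×-dec Edge? c₀ true x y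

    enum : List V
    enum = List.map FV.from (allFin FV.size)

    letters : List (V × V)
    letters = filter Good? (cartesianProduct enum enum)

    m : ℕ
    m = length letters

    letter : Fin m → V × V
    letter = List.lookup letters

    letter-good : ∀ i → Good (letter i)
    letter-good i = proj₂ (∈ₚ.∈-filter⁻ Good? {xs = cartesianProduct enum enum} (∈ₚ.∈-lookup i))

    good-letter : ∀ {p} → Good p → ∃ λ i → p ≡ letter i
    good-letter {x , y} g = Any.index p∈ , Anyₚ.lookup-index p∈
      where
      enum∋ : ∀ x → x ∈ enum
      enum∋ x = subst (_∈ _) (FV.from∘to x) (∈ₚ.∈-map⁺ FV.from (∈ₚ.∈-allFin (FV.to x)))
      p∈ : (x , y) ∈ letters
      p∈ = ∈ₚ.∈-filter⁺ Good? (∈ₚ.∈-cartesianProduct⁺ (enum∋ x) (enum∋ y)) g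

    dim : ℕ
    dim = proj₁ (halesJewett m fin-Bool)

    Line : Set
    Line = Vec (Maybe (V × V)) dim

    Valid : Line → Set
    Valid k = nothing ∈ᵥ k × VAll.All (Constant Good) k

    -- Part, owning line and word. There is no owner in the parts `a` and `b`: vertices there are
    -- known by their words alone, so that lines with equal words share them.
    V⁺ : Set
    V⁺ = Fin N × Maybe Line × Vec V dim

    finLine : Finite Line
    finLine = fin-Vec (fin-Maybe (fin-× finite finite)) dim

    finite⁺ : Finite V⁺
    finite⁺ = fin-× fin-Fin (fin-× (fin-Maybe finLine) (fin-Vec finite dim))

    Valid? : ∀ k → Dec (Valid k)
    Valid? k = VAny.any? (nothing ≟′_) k ×-dec VAll.all? constant? k
      where
      open Finite (fin-Maybe (fin-× finite finite)) using (_≟′_)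
      constant? : ∀ mp → Dec (Constant Good mp)
      constant? nothing  = yes tt
      constant? (just g) = Good? g

    Shared : Fin N → Set
    Shared p = p ≡ a ⊎ p ≡ b

    shared? : ∀ p → Dec (Shared p)
    shared? p = (p ≟ a) ⊎-dec (p ≟ b)

    tag : Fin N → Line → Maybe Line
    tag p k with shared? p
    ... | yes _ = nothing
    ... | no _  = just k

    -- At constant coordinates, words in part `a` list first ends of good pairs and words in part
    -- `b` second ends. In the remaining parts either end would do: the tag names the line there,
    -- and the moving coordinates recover the vertex.
    side : Fin N → V × V → V
    side p with p ≟ a
    ... | yes _ = proj₁
    ... | no _  = proj₂

    -- The copy of the system along a line. Different copies share only vertices in the parts a and b, and two such
    -- vertices in different parts only if they span an active edge of colour c₀ (copies-overlap).
    opaque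
      copy : Line → V → V⁺
      copy k x = part x , tag (part x) k , Vec.map (side (part x)) (fill (x , x) k)

      copy-unfold : ∀ k x → copy k x ≡ (part x , tag (part x) k , Vec.map (side (part x)) (fill (x , x) k))
      copy-unfold k x = refl

      copy-at : ∀ {k x u} → copy k x ≡ u → part x ≡ proj₁ u
      copy-at = cong proj₁

      copy-part : ∀ {k l x y} → copy k x ≡ copy l y → part x ≡ part y
      copy-part = cong proj₁

      copy-tag : ∀ {k l x y} → copy k x ≡ copy l y → tag (part x) k ≡ tag (part y) l
      copy-tag = cong (proj₁ ∘ proj₂)

      copy-word : ∀ {k l x y} → copy k x ≡ copy l y →
        Vec.map (side (part x)) (fill (x , x) k) ≡ Vec.map (side (part y)) (fill (y , y) l)
      copy-word = cong (proj₂ ∘ proj₂)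

    Edge⁺ : Bool → Bool → V⁺ → V⁺ → Set
    Edge⁺ c f u w = ∃ λ k → Valid k × ∃ λ x → ∃ λ y → Edge c f x y × copy k x ≡ u × copy k y ≡ w

    Edge⁺? : ∀ c f u w → Dec (Edge⁺ c f u w)
    Edge⁺? c f u w = Finite.any? finLine λ k → Valid? k ×-dec FV.any? λ x → FV.any? λ y →
      Edge? c f x y ×-dec Finite._≟′_ finite⁺ _ _ ×-dec Finite._≟′_ finite⁺ _ _

    private-tag : ∀ {p k} → ¬ Shared p → tag p k ≡ just k
    private-tag {p} ¬sh with shared? p
    ... | yes sh = ⊥-elim (¬sh sh)
    ... | no _   = refl

    private-copy : ∀ {k l x y} → ¬ Shared (part x) → copy k x ≡ copy l y → k ≡ l
    private-copy {k} {l} {x} {y} ¬sh eq = Maybeₚ.just-injective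
      (trans (sym (private-tag ¬sh)) (trans (copy-tag eq) (private-tag (subst (¬_ ∘ Shared) (copy-part eq) ¬sh))))

    common-shared : ∀ {k l x y} → k ≢ l → copy k x ≡ copy l y → Shared (part x)
    common-shared {x = x} k≢l eq with shared? (part x)
    ... | yes sh = sh
    ... | no ¬sh = ⊥-elim (k≢l (private-copy ¬sh eq))

    side-diagonal : ∀ p x → side p (x , x) ≡ x
    side-diagonal p x with p ≟ a
    ... | yes _ = refl
    ... | no _  = refl

    word-injective : ∀ {n p x y} {k : Vec (Maybe (V × V)) n} → nothing ∈ᵥ k →
      Vec.map (side p) (fill (x , x) k) ≡ Vec.map (side p) (fill (y , y) k) → x ≡ y
    word-injective {p = p} (here refl) eq =
      trans (sym (side-diagonal p _)) (trans (Vecₚ.∷-injectiveˡ eq) (side-diagonal p _))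
    word-injective {p = p} {k = _ ∷ _} (there ★) eq = word-injective {p = p} ★ (Vecₚ.∷-injectiveʳ eq)

    copy-injective : ∀ {k x y} → Valid k → copy k x ≡ copy k y → x ≡ y
    copy-injective {k} {x} {y} (★ , _) eq = word-injective {p = part y} ★
      (trans (cong (λ p → Vec.map (side p) (fill (x , x) k)) (sym (copy-part eq))) (copy-word eq))

    side-a : ∀ {n x} x′ (k : Vec (Maybe (V × V)) n) → part x ≡ a →
      Vec.map (side (part x)) (fill (x , x) k) ≡ Vec.map proj₁ (fill (x , x′) k)
    side-a {x = x} x′ k eq with part x ≟ a
    ... | no ≢a = ⊥-elim (≢a eq)
    ... | yes _ = go k
      where
      go : ∀ {n} (k : Vec (Maybe (V × V)) n) → Vec.map proj₁ (fill (x , x) k) ≡ Vec.map proj₁ (fill (x , x′) k)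
      go []            = refl
      go (nothing ∷ k) = cong (x ∷_) (go k)
      go (just g ∷ k)  = cong (proj₁ g ∷_) (go k)

    side-b : ∀ {n x′} x (k : Vec (Maybe (V × V)) n) → part x′ ≢ a →
      Vec.map (side (part x′)) (fill (x′ , x′) k) ≡ Vec.map proj₂ (fill (x , x′) k)
    side-b {x′ = x′} x k ≢a with part x′ ≟ a
    ... | yes eq = ⊥-elim (≢a eq)
    ... | no _   = go k
      where
      go : ∀ {n} (k : Vec (Maybe (V × V)) n) → Vec.map proj₂ (fill (x′ , x′) k) ≡ Vec.map proj₂ (fill (x , x′) k)
      go []            = refl
      go (nothing ∷ k) = cong (x′ ∷_) (go k)
      go (just g ∷ k)  = cong (proj₂ g ∷_) (go k)

    unzip-injective : ∀ {n} {u w : Vec (V × V) n} → Vec.map proj₁ u ≡ Vec.map proj₁ w →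
                      Vec.map proj₂ u ≡ Vec.map proj₂ w → u ≡ w
    unzip-injective {u = []} {[]} _ _ = refl
    unzip-injective {u = _ ∷ _} {_ ∷ _} eq₁ eq₂ =
      cong₂ _∷_ (cong₂ _,_ (Vecₚ.∷-injectiveˡ eq₁) (Vecₚ.∷-injectiveˡ eq₂))
                (unzip-injective (Vecₚ.∷-injectiveʳ eq₁) (Vecₚ.∷-injectiveʳ eq₂))

    -- Zipped, the words of `x` and `x′` form the point of the line `k` with letter `(x , x′)`. Two
    -- copies with such a pair in common thus give two lines through one point.
    overlap-good : ∀ {k l x x′ y y′} → Valid k → Valid l → k ≢ l → part x ≡ a → part x′ ≡ b → part x ≢ part x′ →
      copy k x ≡ copy l y → copy k x′ ≡ copy l y′ → Good (x , x′) × Good (y , y′)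
    overlap-good {k} {l} {x} {x′} {y} {y′} (★k , ck) (★l , cl) k≢l x∈a x′∈b p≢ eq eq′ =
      lines-meet-in-good Good ★k ★l ck cl k≢l (unzip-injective
        (trans (sym (side-a x′ k x∈a)) (trans (copy-word eq) (side-a y′ l (trans (sym (copy-part eq)) x∈a))))
        (trans (sym (side-b x k x′∉a)) (trans (copy-word eq′) (side-b y l (x′∉a ∘ trans (copy-part eq′))))))
      where
      x′∉a : part x′ ≢ a
      x′∉a x′∈a = p≢ (trans x∈a (sym x′∈a))

    copies-overlap : ∀ {k l x x′ y y′} → Valid k → Valid l → k ≢ l → part x ≢ part x′ →
      copy k x ≡ copy l y → copy k x′ ≡ copy l y′ → Edge c₀ true x x′ × Edge c₀ true y y′
    copies-overlap vk vl k≢l p≢ eq eq′ with common-shared k≢l eq | common-shared k≢l eq′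
    ... | inj₁ x∈a | inj₁ x′∈a = ⊥-elim (p≢ (trans x∈a (sym x′∈a)))
    ... | inj₂ x∈b | inj₂ x′∈b = ⊥-elim (p≢ (trans x∈b (sym x′∈b)))
    ... | inj₁ x∈a | inj₂ x′∈b with overlap-good vk vl k≢l x∈a x′∈b p≢ eq eq′
    ...   | (_ , _ , E) , (_ , _ , E′) = E , E′
    copies-overlap vk vl k≢l p≢ eq eq′ | inj₂ x∈b | inj₁ x′∈a
      with overlap-good vk vl k≢l x′∈a x∈b (p≢ ∘ sym) eq′ eq
    ...   | (_ , _ , E) , (_ , _ , E′) = Edge-sym E , Edge-sym E′

    -- An edge contributed by another copy has both ends in common with this one. By
    -- `copies-overlap` it is active of colour `c₀` in either copy, and `Edge-unique` identifies
    -- colour and flag.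
    copy-induced : ∀ {k c f x y} → Valid k → Edge⁺ c f (copy k x) (copy k y) → Edge c f x y
    copy-induced {k} vk (l , vl , x′ , y′ , E , eq , eq′) with Finite._≟′_ finLine k l
    ... | yes refl = subst₂ (Edge _ _) (copy-injective vl eq) (copy-injective vl eq′) E
    ... | no k≢l with copies-overlap vk vl k≢l
                        (λ p≡ → Edge-part E (trans (copy-part eq) (trans p≡ (sym (copy-part eq′)))))
                        (sym eq) (sym eq′)
    ...   | G , G′ with Edge-unique E G′
    ...     | refl , refl = G

    copy-edge : ∀ {k c f x y} → Valid k → Edge c f x y → Edge⁺ c f (copy k x) (copy k y)
    copy-edge vk E = _ , vk , _ , _ , E , refl , refl

    Mono⁺ : Bool → V⁺ → V⁺ → Set
    Mono⁺ c u w = ∃ λ f → Edge⁺ c f u w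

    Edge⁺-sym : ∀ {c f u w} → Edge⁺ c f u w → Edge⁺ c f w u
    Edge⁺-sym (k , vk , x , y , E , eq , eq′) = k , vk , y , x , Edge-sym E , eq′ , eq

    Edge⁺-part : ∀ {c f u w} → Edge⁺ c f u w → proj₁ u ≢ proj₁ w
    Edge⁺-part (k , vk , x , y , E , eq , eq′) p≡ = Edge-part E (trans (copy-at eq) (trans p≡ (sym (copy-at eq′))))

    Edge⁺-unique : ∀ {c f c′ f′ u w} → Edge⁺ c f u w → Edge⁺ c′ f′ u w → c ≡ c′ × f ≡ f′
    Edge⁺-unique (k , vk , x , y , E , refl , refl) E⁺ = Edge-unique E (copy-induced vk E⁺)

    InCopy : Line → V⁺ → Set
    InCopy k u = ∃ λ x → copy k x ≡ u

    private-edge : ∀ {k c u w} → ¬ Shared (proj₁ u) → InCopy k u → Mono⁺ c u w → InCopy k w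
    private-edge ¬sh (x , eq) (f , l , _ , x′ , y , _ , eq′ , eq″)
      with private-copy (subst (¬_ ∘ Shared) (sym (copy-at eq)) ¬sh) (trans eq (sym eq′))
    ... | refl = y , eq″

    two-parts : ∀ {p q r : Fin N} → p ≢ q → p ≢ r → q ≢ r → Shared p → Shared q → Shared r → ⊥
    two-parts p≢q p≢r q≢r (inj₁ refl) (inj₁ refl) _           = p≢q refl
    two-parts p≢q p≢r q≢r (inj₂ refl) (inj₂ refl) _           = p≢q refl
    two-parts p≢q p≢r q≢r (inj₁ refl) (inj₂ refl) (inj₁ refl) = p≢r refl
    two-parts p≢q p≢r q≢r (inj₁ refl) (inj₂ refl) (inj₂ refl) = q≢r refl
    two-parts p≢q p≢r q≢r (inj₂ refl) (inj₁ refl) (inj₁ refl) = q≢r refl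
    two-parts p≢q p≢r q≢r (inj₂ refl) (inj₁ refl) (inj₂ refl) = p≢r refl

    module _ {c : Bool} {κ : I → V⁺} (clique : Clique (Mono⁺ c) κ) where

      some-private : ∃ λ i → ¬ Shared (proj₁ (κ i))
      some-private with shared? (proj₁ (κ i₀)) | shared? (proj₁ (κ i₁)) | shared? (proj₁ (κ i₂))
      ... | no ¬sh | _ | _ = i₀ , ¬sh
      ... | yes _ | no ¬sh | _ = i₁ , ¬sh
      ... | yes _ | yes _ | no ¬sh = i₂ , ¬sh
      ... | yes s₀ | yes s₁ | yes s₂ = ⊥-elim (two-parts (differ (λ ())) (differ (λ ())) (differ (λ ())) s₀ s₁ s₂)
        where
        differ : ∀ {i j} → i ≢ j → proj₁ (κ i) ≢ proj₁ (κ j)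
        differ i≢j = Edge⁺-part (proj₂ (clique i≢j))

      another : (i : I) → ∃ λ j → i ≢ j
      another (inj₁ _) = i₂ , λ ()
      another (inj₂ _) = i₀ , λ ()

      -- Some vertex of the clique lies in neither of the parts `a` and `b`. Its tag names a copy
      -- that contains all its edges, and it is joined to the entire clique.
      clique-in-copy : ∃ λ k → Valid k × ∀ i → InCopy k (κ i)
      clique-in-copy with some-private
      ... | i , ¬sh with clique (proj₂ (another i))
      ...   | f , k , vk , x , y , E , eq , _ = k , vk , inCopy
        where
        inCopy : ∀ j → InCopy k (κ j)
        inCopy j with i ≟I j
        ... | yes refl = x , eq
        ... | no i≢j   = private-edge ¬sh (x , eq) (clique i≢j)

      clique-lifts : ∃ λ k → Valid k × ∃ λ (λκ : I → V) → (∀ i → copy k (λκ i) ≡ κ i) × Clique (Mono c) λκ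
      clique-lifts with clique-in-copy
      ... | k , vk , inCopy = k , vk , proj₁ ∘ inCopy , proj₂ ∘ inCopy , λ i≢j → lift (clique i≢j)
        where
        lift : ∀ {i j} → Mono⁺ c (κ i) (κ j) → Mono c (proj₁ (inCopy i)) (proj₁ (inCopy j))
        lift {i} {j} (f , E) = f , copy-induced vk
          (subst₂ (Edge⁺ c f) (sym (proj₂ (inCopy i))) (sym (proj₂ (inCopy j))) E)

      clique-passive⁺ : ∀ i j → ¬ Edge⁺ c true (κ i) (κ j)
      clique-passive⁺ i j E with clique-lifts
      ... | k , vk , κ′ , eq , clique′ =
        clique-passive clique′ i j (copy-induced vk (subst₂ (Edge⁺ c true) (sym (eq i)) (sym (eq j)) E))

    -- The `K_t` lies in one copy. If the apex lies outside, two of its neighbours in the `K_t` are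
    -- shared and occupy the parts `a` and `b`, so the apex is private to a single other copy. Both
    -- copies contain these two neighbours, which therefore span an active edge, against
    -- `clique-passive`.
    H-free⁺ : ∀ c → ¬ HCopy (Mono⁺ c)
    H-free⁺ c h with clique-lifts (HCopy.clique h)
    ... | k , vk , κ′ , eq , clique′ = [ outside , inside ]′ inside?
      where
      open HCopy h
      inside? : (¬ InCopy k v) ⊎ InCopy k v
      inside? with FV.any? (λ z → Finite._≟′_ finite⁺ (copy k z) v)
      ... | yes z = inj₂ z
      ... | no ¬z = inj₁ ¬z

      inside : ¬ InCopy k v
      inside (z , refl) = H-free c (record
        { κ      = κ′
        ; v      = z
        ; clique = clique′
        ; apex   = λ i → proj₁ (apex i) ,
                     copy-induced vk (subst (Edge⁺ c _ _) (sym (eq (inj₁ i))) (proj₂ (apex i)))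
        ; fresh  = λ i z≡ → fresh i (trans (cong (copy k) z≡) (eq i)) })

      outside : ¬ ¬ InCopy k v
      outside v∉k with apex zero | apex (suc zero)
      ... | f , l , vl , z , y , E , eqz , eqy | f′ , l′ , vl′ , z′ , y′ , E′ , eqz′ , eqy′ =
        clique-passive clique′ i₀ i₁ (recolour (clique′ {i₀} {i₁} (λ ())) (common-edge v-private))
        where
        l≢k : l ≢ k
        l≢k refl = v∉k (z , eqz)
        l′≢k : l′ ≢ k
        l′≢k refl = v∉k (z′ , eqz′)

        shared-part : ∀ {l i y} → l ≢ k → copy l y ≡ κ i → Shared (proj₁ (κ i))
        shared-part {i = i} l≢k eqy =
          subst Shared (copy-at eqy) (common-shared l≢k (trans eqy (sym (eq i))))

        v-private : ¬ Shared (proj₁ v)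
        v-private sh = two-parts (Edge⁺-part (proj₂ (apex zero))) (Edge⁺-part (proj₂ (apex (suc zero))))
          (Edge⁺-part (proj₂ (clique {i₀} {i₁} (λ ())))) sh (shared-part l≢k eqy) (shared-part l′≢k eqy′)

        common-edge : ¬ Shared (proj₁ v) → Edge c₀ true (κ′ i₀) (κ′ i₁)
        common-edge ¬sh with private-copy (subst (¬_ ∘ Shared) (sym (copy-at eqz)) ¬sh) (trans eqz (sym eqz′))
        ... | refl = proj₁ (copies-overlap vk vl (l≢k ∘ sym) (Edge-part (proj₂ (clique′ {i₀} {i₁} (λ ()))))
                       (trans (eq i₀) (sym eqy)) (trans (eq i₁) (sym eqy′)))

        recolour : ∀ {x y} → Mono c x y → Edge c₀ true x y → Edge c true x y
        recolour (_ , E) E₀ = subst (λ c → Edge c true _ _) (sym (proj₁ (Edge-unique E E₀))) E₀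

    amalgam : System N
    amalgam = record
      { V = V⁺ ; finite = finite⁺ ; part = proj₁ ; Edge = Edge⁺ ; Edge? = Edge⁺? ; Edge-sym = Edge⁺-sym
      ; Edge-part = Edge⁺-part ; Edge-unique = Edge⁺-unique ; clique-passive = clique-passive⁺ ; H-free = H-free⁺ }

    HomogeneousCopy : (V⁺ → V⁺ → Bool) → Set
    HomogeneousCopy χ = ∃ λ k → Valid k × ∃ λ β → ∀ {x y} → Good (x , y) → χ (copy k x) (copy k y) ≡ β

    -- A word of good pairs stands for the two shared vertices formed by its first and its second
    -- ends. Read in this way, the points of a combinatorial line are the active edges of colour
    -- `c₀` from `a` to `b` in one copy, and `χ` colours the words.
    homogeneous-copy : ∀ χ → HomogeneousCopy χ
    homogeneous-copy χ = k , (movingk , constantk L) , proj₁ monochromatic , λ g → value (good-letter g) g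
      where
      end : (V × V → V) → Fin N → Vec (Fin m) dim → V⁺
      end π p u = p , nothing , Vec.map π (Vec.map letter u)

      χ⁺ : Vec (Fin m) dim → Bool
      χ⁺ u = χ (end proj₁ a u) (end proj₂ b u)

      open MonoLine (proj₂ (halesJewett m fin-Bool) χ⁺) renaming (line to L)

      k : Line
      k = Vec.map (Maybe.map letter) L

      movingk : nothing ∈ᵥ k
      movingk = ∈ᵥₚ.∈-map⁺ _ moving

      constantk : ∀ {n} (L : Vec (Maybe (Fin m)) n) → VAll.All (Constant Good) (Vec.map (Maybe.map letter) L)
      constantk []            = []
      constantk (nothing ∷ L) = tt ∷ constantk L
      constantk (just i ∷ L)  = letter-good i ∷ constantk L

      monochromatic : ∃ λ β → ∀ i → χ⁺ (fill i L) ≡ β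
      monochromatic = common-value (λ i → χ⁺ (fill i L)) mono

      fill-letter : ∀ {n} i (L : Vec (Maybe (Fin m)) n) →
        fill (letter i) (Vec.map (Maybe.map letter) L) ≡ Vec.map letter (fill i L)
      fill-letter i []            = refl
      fill-letter i (nothing ∷ L) = cong (_ ∷_) (fill-letter i L)
      fill-letter i (just _ ∷ L)  = cong (_ ∷_) (fill-letter i L)

      shared-tag : ∀ {p} → Shared p → tag p k ≡ nothing
      shared-tag {p} sh with shared? p
      ... | yes _  = refl
      ... | no ¬sh = ⊥-elim (¬sh sh)

      value : ∀ {x y} → (∃ λ i → (x , y) ≡ letter i) → Good (x , y) → χ (copy k x) (copy k y) ≡ proj₁ monochromatic
      value {x} {y} (i , eq) (x∈a , y∈b , E) = trans (cong₂ χ copy-x copy-y) (proj₂ monochromatic i)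
        where
        word : ∀ π → Vec.map π (fill (x , y) k) ≡ Vec.map π (Vec.map letter (fill i L))
        word π = cong (Vec.map π) (trans (cong (λ p → fill p k) eq) (fill-letter i L))
        copy-x : copy k x ≡ end proj₁ a (fill i L)
        copy-x = trans (copy-unfold k x) (cong₂ _,_ x∈a (cong₂ _,_ (shared-tag (inj₁ x∈a)) (trans (side-a y k x∈a) (word proj₁))))
        copy-y : copy k y ≡ end proj₂ b (fill i L)
        copy-y = trans (copy-unfold k y) (cong₂ _,_ y∈b (cong₂ _,_ (shared-tag (inj₂ y∈b))
          (trans (side-b x k (λ y∈a → Edge-part E (trans x∈a (sym y∈a)))) (word proj₂))))

  open System

  record Embedding {M N : ℕ} (S : System M) (T : System N) : Set where
    field
      ι         : V S → V T
      injective : ∀ {x y} → ι x ≡ ι y → x ≡ y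
      edge      : ∀ {c f x y} → Edge S c f x y → Edge T c f (ι x) (ι y)
  open Embedding

  PartPreserving : ∀ {N} {S T : System N} → Embedding S T → Set
  PartPreserving {S = S} {T} ε = ∀ x → part T (ι ε x) ≡ part S x

  Homog : ∀ {N} (S : System N) → (V S → V S → Bool) → Bool → Fin N → Fin N → Set
  Homog S χ c a b = ∃ λ β → ∀ {x y} → part S x ≡ a → part S y ≡ b → Edge S c true x y → χ x y ≡ β

  -- The amalgamations are nested, and a colouring is made homogeneous from the outermost one
  -- inwards: passing to an inner copy preserves parts and active edges, hence what was achieved for
  -- the later triples.
  homogenize : ∀ {N} (ts : List (Bool × Fin N × Fin N)) (S : System N) →
    Σ (System N) λ T → (χ : V T → V T → Bool) → Σ (Embedding S T) λ ε → PartPreserving ε ×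
      (∀ {c a b} → (c , a , b) ∈ ts → Homog S (λ x y → χ (ι ε x) (ι ε y)) c a b)
  homogenize [] S = S , λ χ →
    record { ι = id ; injective = id ; edge = id } , (λ _ → refl) , λ ()
  homogenize ((c₀ , a₀ , b₀) ∷ ts) S = T , λ χ → step χ (proj₂ later χ)
    where
    open Amalgam S c₀ a₀ b₀
    later = homogenize ts amalgam
    T = proj₁ later
    step : ∀ χ → _ → _
    step χ (ε , ε-part , ε-homog) with homogeneous-copy (λ u w → χ (ι ε u) (ι ε w))
    ... | k , vk , β , mono =
      record { ι = ι ε ∘ copy k ; injective = copy-injective vk ∘ injective ε ; edge = edge ε ∘ copy-edge vk } ,
      (λ x → trans (ε-part (copy k x)) (sym (copy-at refl))) ,
      λ { (Any.here refl) → β , λ x∈a y∈b E → mono (x∈a , y∈b , E)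
        ; (Any.there t∈)  → restrict (ε-homog t∈) }
      where
      restrict : ∀ {c a b} → Homog amalgam (λ u w → χ (ι ε u) (ι ε w)) c a b →
                 Homog S (λ x y → χ (ι ε (copy k x)) (ι ε (copy k y))) c a b
      restrict (β , h) = β , λ x∈a y∈b E →
        h (trans (sym (copy-at refl)) x∈a) (trans (sym (copy-at refl)) y∈b) (copy-edge vk E)

  -- A copy of S for every way of spreading its parts over N new ones.
  module Spread {p : ℕ} (S : System p) (N : ℕ) where

    V° : Set
    V° = Vec (Fin N) p × V S

    part° : V° → Fin N
    part° (s , x) = Vec.lookup s (part S x)

    Edge° : Bool → Bool → V° → V° → Set
    Edge° c f u w = proj₁ u ≡ proj₁ w × part° u ≢ part° w × Edge S c f (proj₂ u) (proj₂ w)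

    fin° : Finite V°
    fin° = fin-× (fin-Vec fin-Fin p) (finite S)

    H-free° : ∀ c → ¬ HCopy (λ u w → ∃ λ f → Edge° c f u w)
    H-free° c h = H-free S c (record
      { κ      = proj₂ ∘ κ
      ; v      = proj₂ v
      ; clique = λ i≢j → forget (clique i≢j)
      ; apex   = λ i → forget (apex i)
      ; fresh  = λ i eq → fresh i (cong₂ _,_ (trans (proj₁ (proj₂ (apex zero))) (same i)) eq) })
      where
      open HCopy h
      forget : ∀ {u w} → (∃ λ f → Edge° c f u w) → Mono S c (proj₂ u) (proj₂ w)
      forget (f , _ , _ , E) = f , E
      same : ∀ i → proj₁ (κ i₀) ≡ proj₁ (κ i)
      same (inj₁ zero)    = refl
      same (inj₁ (suc i)) = proj₁ (proj₂ (clique {i₀} {inj₁ (suc i)} (λ ())))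
      same (inj₂ i)       = proj₁ (proj₂ (clique {i₀} {inj₂ i} (λ ())))

    spread : System N
    spread = record
      { V              = V°
      ; finite         = fin°
      ; part           = part°
      ; Edge           = Edge°
      ; Edge?          = λ c f u w → Finite._≟′_ (fin-Vec fin-Fin p) _ _ ×-dec ¬? (_ ≟ _) ×-dec Edge? S c f _ _
      ; Edge-sym       = λ (s≡ , p≢ , E) → sym s≡ , p≢ ∘ sym , Edge-sym S E
      ; Edge-part      = λ (_ , p≢ , _) → p≢
      ; Edge-unique    = λ (_ , _ , E) (_ , _ , E′) → Edge-unique S E E′
      ; clique-passive = λ clique i j (_ , _ , E) → clique-passive S
                           (λ i≢j → let (f , _ , _ , E) = clique i≢j in f , E) i j E
      ; H-free         = H-free° }

  module Forcing {p : ℕ} (S : System p) (part-injective : ∀ {x y} → part S x ≡ part S y → x ≡ y) where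

    N : ℕ
    N = ramsey₂Number p

    triples : List (Bool × Fin N × Fin N)
    triples = cartesianProduct (true ∷ false ∷ []) (cartesianProduct (allFin N) (allFin N))

    ∈-triples : ∀ c a b → (c , a , b) ∈ triples
    ∈-triples c a b = ∈ₚ.∈-cartesianProduct⁺ (bool c) (∈ₚ.∈-cartesianProduct⁺ (∈ₚ.∈-allFin a) (∈ₚ.∈-allFin b))
      where
      bool : ∀ c → c ∈ (true ∷ false ∷ [])
      bool true  = Any.here refl
      bool false = Any.there (Any.here refl)

    open Spread S N using (spread)

    forcing : System N
    forcing = proj₁ (homogenize triples spread)

    ActiveHomogeneous : (V forcing → V forcing → Bool) → Set
    ActiveHomogeneous χ = Σ (Embedding S forcing) λ ε → Σ (Bool → Bool) λ γ →
      ∀ {c x y} → Edge S c true x y → χ (ι ε x) (ι ε y) ≡ γ c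

    -- In a homogenized copy the colour of an active edge depends only on its intended colour and on
    -- its two parts. Ramsey's theorem selects `p` parts for which only their order still matters,
    -- and the symmetry of `χ` removes the order. The spreading onto these parts is the desired copy
    -- of `S`.
    force : ∀ χ → (∀ x y → χ x y ≡ χ y x) → ActiveHomogeneous χ
    force χ χ-sym with proj₂ (homogenize triples spread) χ
    ... | ε , _ , homog with ramsey₂ p (λ c a b → proj₁ (homog (∈-triples c a b)))
    ...   | s , γ , s-homog = record { ι = ι ε ∘ place ; injective = place-injective ∘ injective ε
                                     ; edge = λ E → edge ε (place-edge E) } , γ , λ E → active E (Finₚ.<-cmp _ _)
      where
      place : V S → V spread
      place x = Vec.tabulate s , x

      place-injective : ∀ {x y} → place x ≡ place y → x ≡ y
      place-injective = cong proj₂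

      part-place : ∀ x → part spread (place x) ≡ s (part S x)
      part-place x = Vecₚ.lookup∘tabulate s (part S x)

      s-distinct : ∀ {i j} → i ≢ j → s i ≢ s j
      s-distinct {i} {j} i≢j with Finₚ.<-cmp i j
      ... | tri< i<j _ _ = proj₁ (s-homog i<j)
      ... | tri≈ _ i≡j _ = ⊥-elim (i≢j i≡j)
      ... | tri> _ _ j<i = proj₁ (s-homog j<i) ∘ sym

      place-edge : ∀ {c f x y} → Edge S c f x y → Edge spread c f (place x) (place y)
      place-edge {x = x} {y} E = refl ,
        (λ p≡ → s-distinct (Edge-part S E) (trans (sym (part-place x)) (trans p≡ (part-place y)))) , E

      ascending : ∀ {c x y} → Edge S c true x y → part S x Fin.< part S y → χ (ι ε (place x)) (ι ε (place y)) ≡ γ c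
      ascending {c} {x} {y} E x<y =
        trans (proj₂ (homog (∈-triples c _ _)) (part-place x) (part-place y) (place-edge E)) (proj₂ (s-homog x<y) c)

      active : ∀ {c x y} → Edge S c true x y → Tri (part S x Fin.< part S y) (part S x ≡ part S y) (part S y Fin.< part S x) →
               χ (ι ε (place x)) (ι ε (place y)) ≡ γ c
      active E (tri< x<y _ _) = ascending E x<y
      active E (tri≈ _ x≡y _) = ⊥-elim (Edge-part S E x≡y)
      active E (tri> _ _ y<x) = trans (χ-sym _ _) (ascending (Edge-sym S E) y<x)

  -- The pattern

  open System
  open Embedding

  no-injection-Maybe : ∀ {A : Set} → Finite A → (f : Maybe A → A) → (∀ {x y} → f x ≡ f y → x ≡ y) → ⊥
  no-injection-Maybe fA f inj = ℕₚ.1+n≰n (Finₚ.injective⇒≤ {f = to ∘ f ∘ decode} (decode-injective ∘ inj ∘ to-injective))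
    where
    open Finite fA
    decode : Fin (suc size) → Maybe _
    decode zero    = nothing
    decode (suc i) = just (from i)
    decode-injective : ∀ {i j} → decode i ≡ decode j → i ≡ j
    decode-injective {zero}  {zero}  _  = refl
    decode-injective {suc i} {suc j} eq = cong suc (from-injective (Maybeₚ.just-injective eq))

  maybe-injective : ∀ {A B : Set} {f : Maybe A → B} → (∀ {x y} → f (just x) ≡ f (just y) → x ≡ y) →
                    (∀ x → f nothing ≢ f (just x)) → ∀ {x y} → f x ≡ f y → x ≡ y
  maybe-injective inj new {nothing} {nothing} _  = refl
  maybe-injective inj new {nothing} {just y}  eq = ⊥-elim (new y eq)
  maybe-injective inj new {just x}  {nothing} eq = ⊥-elim (new x (sym eq))
  maybe-injective inj new {just x}  {just y}  eq = cong just (inj eq)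

  fin-I : Finite I
  fin-I = fin-⊎ fin-Fin fin-Fin

  clique-injective : ∀ {V B : Set} {R : V → V → Set} {κ : I → V} (f : V → B) → (∀ {u w} → R u w → f u ≢ f w) →
                     Clique R κ → ∀ {i j} → f (κ i) ≡ f (κ j) → i ≡ j
  clique-injective f distinct clique {i} {j} eq with i ≟I j
  ... | yes i≡j = i≡j
  ... | no i≢j  = ⊥-elim (distinct (clique i≢j) eq)

  -- Red edges join vertices of the same row (red K_t on d core and e extra vertices);
  -- blue edges join core vertices of different rows, and each transversal T of the core to its own e extra vertices.
  data Skeleton : Set where
    core : Fin d → Fin d → Skeleton
    redx : Fin d → Fin e → Skeleton
    blux : Vec (Fin d) d → Fin e → Skeleton

  fin-Skeleton : Finite Skeleton
  fin-Skeleton = fin-↔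
    (mk↔ₛ′ (λ { (core i j) → inj₁ (i , j) ; (redx i k) → inj₂ (inj₁ (i , k)) ; (blux T k) → inj₂ (inj₂ (T , k)) })
           (λ { (inj₁ (i , j)) → core i j ; (inj₂ (inj₁ (i , k))) → redx i k ; (inj₂ (inj₂ (T , k))) → blux T k })
           (λ { (inj₁ _) → refl ; (inj₂ (inj₁ _)) → refl ; (inj₂ (inj₂ _)) → refl })
           (λ { (core _ _) → refl ; (redx _ _) → refl ; (blux _ _) → refl }))
    (fin-⊎ (fin-× fin-Fin fin-Fin) (fin-⊎ (fin-× fin-Fin fin-Fin) (fin-× (fin-Vec fin-Fin d) fin-Fin)))

  D : Bool → Skeleton → Skeleton → Set
  D true  (core i j) (core i′ j′) = i ≡ i′ × j ≢ j′
  D true  (core i j) (redx i′ k)  = i ≡ i′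
  D true  (redx i k) (core i′ j)  = i ≡ i′
  D true  (redx i k) (redx i′ k′) = i ≡ i′ × k ≢ k′
  D false (core i j) (core i′ j′) = i ≢ i′
  D false (core i j) (blux T k)   = Vec.lookup T i ≡ j
  D false (blux T k) (core i j)   = Vec.lookup T i ≡ j
  D false (blux T k) (blux T′ k′) = T ≡ T′ × k ≢ k′
  D _     _          _            = ⊥

  D? : ∀ c u w → Dec (D c u w)
  D? true  (core i j) (core i′ j′) = (i ≟ i′) ×-dec ¬? (j ≟ j′)
  D? true  (core i j) (redx i′ k)  = i ≟ i′
  D? true  (core i j) (blux T k)   = no λ ()
  D? true  (redx i k) (core i′ j)  = i ≟ i′
  D? true  (redx i k) (redx i′ k′) = (i ≟ i′) ×-dec ¬? (k ≟ k′)
  D? true  (redx i k) (blux T k′)  = no λ ()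
  D? true  (blux T k) _            = no λ ()
  D? false (core i j) (core i′ j′) = ¬? (i ≟ i′)
  D? false (core i j) (redx i′ k)  = no λ ()
  D? false (core i j) (blux T k)   = Vec.lookup T i ≟ j
  D? false (redx i k) _            = no λ ()
  D? false (blux T k) (core i j)   = Vec.lookup T i ≟ j
  D? false (blux T k) (redx i k′)  = no λ ()
  D? false (blux T k) (blux T′ k′) = Finite._≟′_ (fin-Vec fin-Fin d) T T′ ×-dec ¬? (k ≟ k′)

  D-sym : ∀ c {u w} → D c u w → D c w u
  D-sym true  {core _ _} {core _ _} (refl , j≢) = refl , j≢ ∘ sym
  D-sym true  {core _ _} {redx _ _} refl        = refl
  D-sym true  {redx _ _} {core _ _} refl        = refl
  D-sym true  {redx _ _} {redx _ _} (refl , k≢) = refl , k≢ ∘ sym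
  D-sym false {core _ _} {core _ _} i≢          = i≢ ∘ sym
  D-sym false {core _ _} {blux _ _} T≡          = T≡
  D-sym false {blux _ _} {core _ _} T≡          = T≡
  D-sym false {blux _ _} {blux _ _} (refl , k≢) = refl , k≢ ∘ sym

  D-irreflexive : ∀ c {u} → ¬ D c u u
  D-irreflexive true  {core _ _} (_ , j≢) = j≢ refl
  D-irreflexive true  {redx _ _} (_ , k≢) = k≢ refl
  D-irreflexive false {core _ _} i≢       = i≢ refl
  D-irreflexive false {blux _ _} (_ , k≢) = k≢ refl

  D-red-or-blue : ∀ {u w} → D true u w → ¬ D false u w
  D-red-or-blue {core _ _} {core _ _} (i≡ , _) i≢ = i≢ i≡

  D-not : ∀ c {u w} → D c u w → ¬ D (not c) u w
  D-not true  Du Dw = D-red-or-blue Du Dw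
  D-not false Du Dw = D-red-or-blue Dw Du

  row : Fin d → I → Skeleton
  row i (inj₁ j) = core i j
  row i (inj₂ k) = redx i k

  row-clique : ∀ i → Clique (D true) (row i)
  row-clique i {inj₁ _} {inj₁ _} ≢j = refl , ≢j ∘ cong inj₁
  row-clique i {inj₁ _} {inj₂ _} _  = refl
  row-clique i {inj₂ _} {inj₁ _} _  = refl
  row-clique i {inj₂ _} {inj₂ _} ≢k = refl , ≢k ∘ cong inj₂

  block : Vec (Fin d) d → I → Skeleton
  block T (inj₁ i) = core i (Vec.lookup T i)
  block T (inj₂ k) = blux T k

  block-clique : ∀ T → Clique (D false) (block T)
  block-clique T {inj₁ _} {inj₁ _} ≢i = ≢i ∘ cong inj₁
  block-clique T {inj₁ _} {inj₂ _} _  = refl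
  block-clique T {inj₂ _} {inj₁ _} _  = refl
  block-clique T {inj₂ _} {inj₂ _} ≢k = refl , ≢k ∘ cong inj₂

  InRow : Fin d → Skeleton → Set
  InRow i u = ∃ λ a → row i a ≡ u

  red-row : ∀ {u w} → D true u w → ∃ λ i → InRow i u
  red-row {core i j} {core _ _} _ = i , inj₁ j , refl
  red-row {core i j} {redx _ _} _ = i , inj₁ j , refl
  red-row {redx i k} {core _ _} _ = i , inj₂ k , refl
  red-row {redx i k} {redx _ _} _ = i , inj₂ k , refl

  red-same-row : ∀ {i u w} → InRow i u → D true u w → InRow i w
  red-same-row {w = core _ j} (inj₁ _ , refl) (refl , _) = inj₁ j , refl
  red-same-row {w = redx _ k} (inj₁ _ , refl) refl       = inj₂ k , refl
  red-same-row {w = core _ j} (inj₂ _ , refl) refl       = inj₁ j , refl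
  red-same-row {w = redx _ k} (inj₂ _ , refl) (refl , _) = inj₂ k , refl

  crowded : ∀ {V : Set} {R : V → V → Set} (h : HCopy R) (place : I → V) → (∀ {u} → ¬ R u u) →
            (∀ i → ∃ λ a → place a ≡ HCopy.κ h i) → (∃ λ a → place a ≡ HCopy.v h) → ⊥
  crowded {R = R} h place irr κ-placed (a , v≡) = no-injection-Maybe fin-I index
    (maybe-injective {f = index}
      (λ {i} {j} eq → clique-injective {R = R} id (λ { Ruw refl → irr Ruw }) clique
        (trans (sym (proj₂ (κ-placed i))) (trans (cong place eq) (proj₂ (κ-placed j)))))
      (λ i eq → fresh i (trans (sym v≡) (trans (cong place eq) (proj₂ (κ-placed i))))))
    where
    open HCopy h
    index : Maybe I → I
    index nothing  = a
    index (just i) = proj₁ (κ-placed i)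

  -- The red edges form disjoint `K_t`'s, the rows, whereas H is connected and has t + 1 vertices.
  red-H-free : ¬ HCopy (D true)
  red-H-free h with red-row (HCopy.clique h {i₀} {i₂} (λ ()))
  ... | i , κ₀∈ = crowded h (row i) (D-irreflexive true) placed (red-same-row κ₀∈ (D-sym true (apex zero)))
    where
    open HCopy h
    placed : ∀ j → InRow i (κ j)
    placed j with i₀ ≟I j
    ... | yes refl = κ₀∈
    ... | no i₀≢j  = red-same-row κ₀∈ (clique i₀≢j)

  InBlock : Vec (Fin d) d → Skeleton → Set
  InBlock T u = ∃ λ a → block T a ≡ u

  blue-block : ∀ {T k w} → D false (blux T k) w → InBlock T w
  blue-block {w = core i _} refl       = inj₁ i , refl
  blue-block {w = blux _ k} (refl , _) = inj₂ k , refl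

  data IsBlux : Skeleton → Set where
    blux : ∀ T k → IsBlux (blux T k)

  isBlux? : ∀ u → Dec (IsBlux u)
  isBlux? (core _ _) = no λ ()
  isBlux? (redx _ _) = no λ ()
  isBlux? (blux T k) = yes (blux T k)

  rowOf : Skeleton → Fin d
  rowOf (core i _) = i
  rowOf (redx i _) = i
  rowOf (blux _ _) = zero

  blue-rows-differ : ∀ {u w} → ¬ IsBlux u → ¬ IsBlux w → D false u w → rowOf u ≢ rowOf w
  blue-rows-differ {core _ _} {core _ _} _ _ i≢  = i≢
  blue-rows-differ {_}        {blux T k} _ ¬b _  = ⊥-elim (¬b (blux T k))
  blue-rows-differ {blux T k} {core _ _} ¬b _ _  = ⊥-elim (¬b (blux T k))

  -- Blue edges inside the core join different rows, and there are only d < t rows.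
  blue-clique-has-blux : ∀ {κ} → Clique (D false) κ → ∃ λ i → IsBlux (κ i)
  blue-clique-has-blux {κ} clique with Finite.any? fin-I (λ i → isBlux? (κ i))
  ... | yes found = found
  ... | no none   = ⊥-elim (no-injection-Maybe fin-Fin (rowOf ∘ κ ∘ choose)
                      (choose-injective ∘ clique-injective′))
    where
    choose : Maybe (Fin d) → I
    choose nothing  = i₂
    choose (just i) = inj₁ i
    choose-injective : ∀ {a b} → choose a ≡ choose b → a ≡ b
    choose-injective {nothing} {nothing} _    = refl
    choose-injective {just _}  {just _}  refl = refl
    clique-injective′ : ∀ {i j} → rowOf (κ i) ≡ rowOf (κ j) → i ≡ j
    clique-injective′ {i} {j} eq with i ≟I j
    ... | yes i≡j = i≡j
    ... | no i≢j  = ⊥-elim (blue-rows-differ (λ b → none (i , b)) (λ b → none (j , b)) (clique i≢j) eq)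

  -- The blue neighbours of an outside vertex in the block are core vertices of the rows other than
  -- `i*`: at most d - 1, too few for an apex. For a core vertex `i*` is its own row, for an extra
  -- vertex of another transversal a row where the transversals differ.
  missed-row : ∀ T v → ¬ InBlock T v → ∃ λ i* → ∀ a → D false v (block T a) → ∃ λ i → i* ≢ i × a ≡ inj₁ i
  missed-row T (core i j) out = i , λ
    { (inj₁ i′) i≢i′ → i′ , i≢i′ , refl
    ; (inj₂ k)  T≡j  → ⊥-elim (out (inj₁ i , cong (core i) T≡j)) }
  -- Such a vertex has no blue edges, so any row will do.
  missed-row T (redx _ _) out = zero , λ { (inj₁ _) () ; (inj₂ _) () }
  missed-row T (blux T′ k) out with Finₚ.any? (λ i → ¬? (Vec.lookup T′ i ≟ Vec.lookup T i))
  ... | yes (i* , ≢i) = i* , λ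
    { (inj₁ i) eq → i , (λ { refl → ≢i eq }) , refl
    ; (inj₂ _) (refl , _) → ⊥-elim (≢i refl) }
  ... | no same = ⊥-elim (out (inj₂ k , cong (λ T → blux T k) (begin
      T                            ≡⟨ sym (Vecₚ.tabulate∘lookup T) ⟩
      Vec.tabulate (Vec.lookup T)  ≡⟨ Vecₚ.tabulate-cong (λ i → sym (equal i)) ⟩
      Vec.tabulate (Vec.lookup T′) ≡⟨ Vecₚ.tabulate∘lookup T′ ⟩
      T′                           ∎)))
    where
    open ≡-Reasoning
    equal : ∀ i → Vec.lookup T′ i ≡ Vec.lookup T i
    equal i with Vec.lookup T′ i ≟ Vec.lookup T i
    ... | yes eq = eq
    ... | no ≢i  = ⊥-elim (same (i , ≢i))

  -- The `K_t` contains an extra vertex of some transversal `T` and hence stays within the block of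
  -- `T`. That block has only t vertices, so it cannot hold the apex as well; outside, `missed-row`
  -- applies.
  blue-H-free : ¬ HCopy (D false)
  blue-H-free h = let (i , isblux) = blue-clique-has-blux clique in around isblux refl
    where
    open HCopy h

    module InOneBlock (T : Vec (Fin d) d) (placed : ∀ j → InBlock T (κ j)) (v∉ : ¬ InBlock T v) where

      i* : Fin d
      i* = proj₁ (missed-row T v v∉)

      neighbour : ∀ j → ∃ λ i → i* ≢ i × proj₁ (placed (inj₁ j)) ≡ inj₁ i
      neighbour j = proj₂ (missed-row T v v∉) _ (subst (D false v) (sym (proj₂ (placed (inj₁ j)))) (apex j))

      column : Maybe (Fin d) → Fin d
      column nothing  = i*
      column (just j) = proj₁ (neighbour j)

      at : ∀ j → block T (inj₁ (column (just j))) ≡ κ (inj₁ j)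
      at j = trans (cong (block T) (sym (proj₂ (proj₂ (neighbour j))))) (proj₂ (placed (inj₁ j)))

      column-injective : ∀ {j j′} → column (just j) ≡ column (just j′) → j ≡ j′
      column-injective {j} {j′} eq = inj₁-injective
        (clique-injective {R = D false} id (λ { Du refl → D-irreflexive false Du }) clique
          (trans (sym (at j)) (trans (cong (λ i → block T (inj₁ i)) eq) (at j′))))

      impossible : ⊥
      impossible = no-injection-Maybe fin-Fin column
        (maybe-injective {f = column} column-injective (λ j → proj₁ (proj₂ (neighbour j))))

    placed : ∀ {i T k} → blux T k ≡ κ i → ∀ j → InBlock T (κ j)
    placed {i} {k = k} u≡ j with i ≟I j
    ... | yes refl = inj₂ k , u≡
    ... | no i≢j   = blue-block (subst (λ u → D false u (κ j)) (sym u≡) (clique i≢j))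

    around : ∀ {i u} → IsBlux u → u ≡ κ i → ⊥
    around (blux T k) u≡ with Finite.any? fin-I (λ a → Finite._≟′_ fin-Skeleton (block T a) v)
    ... | yes v∈ = crowded h (block T) (D-irreflexive false) (placed u≡) v∈
    ... | no v∉ = InOneBlock.impossible T (placed u≡) v∉

  skeleton-H-free : ∀ c → ¬ HCopy (D c)
  skeleton-H-free true  = red-H-free
  skeleton-H-free false = blue-H-free

  -- The pattern: gadgets at the edges of the skeleton

  open System
  open Embedding

  -- One class for each of the t - 2 vertices of a `K_t` other than `u` and `w`, split as in `I`
  -- into neighbours of the apex and the rest.
  M : Set
  M = Fin d′ ⊎ Fin e

  -- The gadget at a skeleton edge uw is a complete multipartite graph with classes of size 2 indexed by M, all joined
  -- to u and w. Together with uw it contains H, with uw between two neighbours of the apex; without uw it has no K_t.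
  -- All its edges are active of the colour opposite to uw: once they are monochromatic, uw must avoid their colour.
  Gadget : Set
  Gadget = Skeleton × Skeleton × M × Bool

  Vᵖ : Set
  Vᵖ = Skeleton ⊎ Gadget

  fin-M : Finite M
  fin-M = fin-⊎ fin-Fin fin-Fin

  finᵖ : Finite Vᵖ
  finᵖ = fin-⊎ fin-Skeleton (fin-× fin-Skeleton (fin-× fin-Skeleton (fin-× fin-M fin-Bool)))

  -- Gadget vertices are provided for all ordered pairs of skeleton vertices; at pairs that are not
  -- skeleton edges they stay isolated.
  Edgeᵖ : Bool → Bool → Vᵖ → Vᵖ → Set
  Edgeᵖ c false (inj₁ u) (inj₁ w)                              = D c u w
  Edgeᵖ c true  (inj₁ z) (inj₂ (u , w , _))                    = D (not c) u w × (z ≡ u ⊎ z ≡ w)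
  Edgeᵖ c true  (inj₂ (u , w , _)) (inj₁ z)                    = D (not c) u w × (z ≡ u ⊎ z ≡ w)
  Edgeᵖ c true  (inj₂ (u , w , m , _)) (inj₂ (u′ , w′ , m′ , _)) = D (not c) u w × u ≡ u′ × w ≡ w′ × m ≢ m′
  Edgeᵖ _ _     _ _                                            = ⊥

  Edgeᵖ? : ∀ c f u w → Dec (Edgeᵖ c f u w)
  Edgeᵖ? c false (inj₁ u) (inj₁ w) = D? c u w
  Edgeᵖ? c false (inj₁ _) (inj₂ _) = no λ ()
  Edgeᵖ? c false (inj₂ _) _        = no λ ()
  Edgeᵖ? c true  (inj₁ _) (inj₁ _) = no λ ()
  Edgeᵖ? c true  (inj₁ z) (inj₂ (u , w , _)) = D? (not c) u w ×-dec ((z ≟ˢ u) ⊎-dec (z ≟ˢ w))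
    where open Finite fin-Skeleton renaming (_≟′_ to _≟ˢ_)
  Edgeᵖ? c true  (inj₂ (u , w , _)) (inj₁ z) = D? (not c) u w ×-dec ((z ≟ˢ u) ⊎-dec (z ≟ˢ w))
    where open Finite fin-Skeleton renaming (_≟′_ to _≟ˢ_)
  Edgeᵖ? c true  (inj₂ (u , w , m , _)) (inj₂ (u′ , w′ , m′ , _)) =
    D? (not c) u w ×-dec (u ≟ˢ u′) ×-dec (w ≟ˢ w′) ×-dec ¬? (Finite._≟′_ fin-M m m′)
    where open Finite fin-Skeleton renaming (_≟′_ to _≟ˢ_)

  Edgeᵖ-sym : ∀ {c f u w} → Edgeᵖ c f u w → Edgeᵖ c f w u
  Edgeᵖ-sym {c} {false} {inj₁ _} {inj₁ _} E = D-sym c E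
  Edgeᵖ-sym {c} {true}  {inj₁ _} {inj₂ _} E = E
  Edgeᵖ-sym {c} {true}  {inj₂ _} {inj₁ _} E = E
  Edgeᵖ-sym {c} {true}  {inj₂ _} {inj₂ _} (Du , refl , refl , m≢) = Du , refl , refl , m≢ ∘ sym

  Edgeᵖ-irreflexive : ∀ {c f u} → ¬ Edgeᵖ c f u u
  Edgeᵖ-irreflexive {c} {false} {inj₁ _} E = D-irreflexive c E
  Edgeᵖ-irreflexive {c} {true}  {inj₂ _} (_ , _ , _ , m≢) = m≢ refl

  D-colour : ∀ {c c′ u w} → D c u w → D c′ u w → c ≡ c′
  D-colour {true}  {true}  _  _  = refl
  D-colour {true}  {false} Du Dw = ⊥-elim (D-red-or-blue Du Dw)
  D-colour {false} {true}  Du Dw = ⊥-elim (D-red-or-blue Dw Du)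
  D-colour {false} {false} _  _  = refl

  Edgeᵖ-unique : ∀ {c f c′ f′ u w} → Edgeᵖ c f u w → Edgeᵖ c′ f′ u w → c ≡ c′ × f ≡ f′
  Edgeᵖ-unique {f = false} {f′ = false} {inj₁ _} {inj₁ _} E E′ = D-colour E E′ , refl
  Edgeᵖ-unique {f = true}  {f′ = true}  {inj₁ _} {inj₂ _} (E , _) (E′ , _) = Boolₚ.not-injective (D-colour E E′) , refl
  Edgeᵖ-unique {f = true}  {f′ = true}  {inj₂ _} {inj₁ _} (E , _) (E′ , _) = Boolₚ.not-injective (D-colour E E′) , refl
  Edgeᵖ-unique {f = true}  {f′ = true}  {inj₂ _} {inj₂ _} (E , _) (E′ , _) = Boolₚ.not-injective (D-colour E E′) , refl
  Edgeᵖ-unique {f = false} {f′ = true}  {inj₁ _} {inj₁ _} _ ()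
  Edgeᵖ-unique {f = true}  {f′ = false} {inj₁ _} {inj₁ _} ()
  Edgeᵖ-unique {f = true}  {f′ = false} {inj₁ _} {inj₂ _} _ ()
  Edgeᵖ-unique {f = true}  {f′ = false} {inj₂ _} {_}      _ ()

  Monoᵖ : Bool → Vᵖ → Vᵖ → Set
  Monoᵖ c u w = ∃ λ f → Edgeᵖ c f u w

  mono-skeleton : ∀ {c u w} → Monoᵖ c (inj₁ u) (inj₁ w) → D c u w
  mono-skeleton (false , E) = E

  mono-gadget : ∀ {c z u w m} → Monoᵖ c (inj₂ (u , w , m)) (inj₁ z) → D (not c) u w × (z ≡ u ⊎ z ≡ w)
  mono-gadget (true , E) = E

  ends-not-joined : ∀ {c g z z′} → Monoᵖ c (inj₂ g) (inj₁ z) → Monoᵖ c (inj₂ g) (inj₁ z′) → ¬ D c z z′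
  ends-not-joined {c} E E′ Dz with mono-gadget E | mono-gadget E′
  ... | Du , inj₁ refl | _ , inj₁ refl = D-irreflexive c Dz
  ... | Du , inj₁ refl | _ , inj₂ refl = D-not c Dz Du
  ... | Du , inj₂ refl | _ , inj₁ refl = D-not c (D-sym c Dz) Du
  ... | Du , inj₂ refl | _ , inj₂ refl = D-irreflexive c Dz

  -- The skeleton neighbours of a gadget vertex in one colour are not joined in that colour. So a
  -- clique through it has at most one skeleton vertex and at most one vertex from each of the t - 2
  -- classes.
  no-gadget-vertex : ∀ {c κ} → Clique (Monoᵖ c) κ → ∀ {i g} → κ i ≢ inj₂ g
  no-gadget-vertex {c} {κ} clique {i} {g} κi = no-injection-Maybe (fin-Maybe fin-M) (class ∘ κ ∘ spot)
    (spot-injective ∘ class-distinct)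
    where
    class : Vᵖ → Maybe M
    class (inj₁ _)               = nothing
    class (inj₂ (_ , _ , m , _)) = just m

    spot : Maybe (Maybe M) → I
    spot nothing                = i₀
    spot (just nothing)         = i₁
    spot (just (just (inj₁ m))) = inj₁ (suc (suc m))
    spot (just (just (inj₂ m))) = inj₂ m

    spot-injective : ∀ {a b} → spot a ≡ spot b → a ≡ b
    spot-injective {nothing}              {nothing}              _    = refl
    spot-injective {just nothing}         {just nothing}         _    = refl
    spot-injective {just (just (inj₁ _))} {just (just (inj₁ _))} refl = refl
    spot-injective {just (just (inj₂ _))} {just (just (inj₂ _))} refl = refl
    spot-injective {nothing}              {just nothing}         ()
    spot-injective {nothing}              {just (just (inj₁ _))} ()
    spot-injective {nothing}              {just (just (inj₂ _))} ()
    spot-injective {just nothing}         {just (just (inj₁ _))} ()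
    spot-injective {just nothing}         {just (just (inj₂ _))} ()

    sees : ∀ {j z} → κ j ≡ inj₁ z → Monoᵖ c (inj₂ g) (inj₁ z)
    sees {j} κj with i ≟I j
    ... | no i≢j = subst₂ (Monoᵖ c) κi κj (clique i≢j)
    sees {j} κj | yes refl with trans (sym κi) κj
    ... | ()

    class-distinct : ∀ {j j′} → class (κ j) ≡ class (κ j′) → j ≡ j′
    class-distinct {j} {j′} eq with j ≟I j′
    ... | yes j≡j′ = j≡j′
    ... | no j≢j′ = ⊥-elim (distinct (clique j≢j′) refl refl eq)
      where
      distinct : ∀ {u w} → Monoᵖ c u w → u ≡ κ j → w ≡ κ j′ → class u ≢ class w
      distinct {inj₁ _} {inj₁ _} E κj κj′ _ = ends-not-joined (sees (sym κj)) (sees (sym κj′)) (mono-skeleton E)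
      distinct {inj₂ _} {inj₂ _} (true , _ , _ , _ , m≢) _ _ eq = m≢ (Maybeₚ.just-injective eq)

  clique-on-skeleton : ∀ {c κ} → Clique (Monoᵖ c) κ → ∀ i → ∃ λ z → κ i ≡ inj₁ z
  clique-on-skeleton {κ = κ} clique i with κ i in eq
  ... | inj₁ z = z , refl
  ... | inj₂ g = ⊥-elim (no-gadget-vertex clique eq)

  clique-passiveᵖ : ∀ {c κ} → Clique (Monoᵖ c) κ → ∀ i j → ¬ Edgeᵖ c true (κ i) (κ j)
  clique-passiveᵖ {c} clique i j E with clique-on-skeleton clique i | clique-on-skeleton clique j
  ... | z , κi | z′ , κj = subst₂ (Edgeᵖ c true) κi κj E

  -- The `K_t` lies on the skeleton. The apex cannot be a gadget vertex, because it has two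
  -- neighbours that are joined in the same colour.
  H-freeᵖ : ∀ c → ¬ HCopy (Monoᵖ c)
  H-freeᵖ c h = at-apex v refl
    where
    open HCopy h
    κ′ : I → Skeleton
    κ′ i = proj₁ (clique-on-skeleton clique i)
    eq : ∀ i → κ i ≡ inj₁ (κ′ i)
    eq i = proj₂ (clique-on-skeleton clique i)
    clique′ : Clique (D c) κ′
    clique′ i≢j = mono-skeleton (subst₂ (Monoᵖ c) (eq _) (eq _) (clique i≢j))
    apex′ : ∀ {u} → v ≡ u → ∀ i → Monoᵖ c u (inj₁ (κ′ (inj₁ i)))
    apex′ v≡ i = subst₂ (Monoᵖ c) v≡ (eq (inj₁ i)) (apex i)

    at-apex : ∀ u → v ≡ u → ⊥
    at-apex (inj₁ z) v≡ = skeleton-H-free c (record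
      { κ = κ′ ; v = z ; clique = clique′ ; apex = mono-skeleton ∘ apex′ v≡
      ; fresh = λ i z≡ → fresh i (trans v≡ (trans (cong inj₁ z≡) (sym (eq i)))) })
    at-apex (inj₂ g) v≡ = ends-not-joined (apex′ v≡ zero) (apex′ v≡ (suc zero)) (clique′ {i₀} {i₁} (λ ()))

  pattern-system : System (Finite.size finᵖ)
  pattern-system = record
    { V = Vᵖ ; finite = finᵖ ; part = Finite.to finᵖ ; Edge = Edgeᵖ ; Edge? = Edgeᵖ?
    ; Edge-sym = λ {c} {f} {u} {w} → Edgeᵖ-sym {c} {f} {u} {w}
    ; Edge-part = λ {c} {f} {u} {w} E eq → Edgeᵖ-irreflexive {c} {f} {u}
        (subst (Edgeᵖ c f u) (sym (Finite.to-injective finᵖ {u} {w} eq)) E)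
    ; Edge-unique = λ {c} {f} {c′} {f′} {u} {w} → Edgeᵖ-unique {c} {f} {c′} {f′} {u} {w}
    ; clique-passive = clique-passiveᵖ ; H-free = H-freeᵖ }

  module Forced = Forcing pattern-system (Finite.to-injective finᵖ)

  opaque
    Q : System Forced.N
    Q = Forced.forcing

    Q-forced : (χ : V Q → V Q → Bool) → (∀ x y → χ x y ≡ χ y x) → Σ (Embedding pattern-system Q) λ ε →
      Σ (Bool → Bool) λ γ → ∀ {c x y} → Edgeᵖ c true x y → χ (ι ε x) (ι ε y) ≡ γ c
    Q-forced = Forced.force

  -- Q together with a new vertex for every d × d array of its vertices, joined to the entries.
  VF : Set
  VF = V Q ⊎ Vec (Vec (V Q) d) d

  finF : Finite VF
  finF = fin-⊎ (finite Q) (fin-Vec (fin-Vec (finite Q) d) d)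

  Entry : ∀ {A : Set} {m n} → A → Vec (Vec A m) n → Set
  Entry x w = ∃ λ i → ∃ λ j → Vec.lookup (Vec.lookup w i) j ≡ x

  RF : VF → VF → Set
  RF (inj₁ x) (inj₁ y) = ∃ λ c → ∃ λ f → Edge Q c f x y
  RF (inj₁ x) (inj₂ w) = Entry x w
  RF (inj₂ w) (inj₁ x) = Entry x w
  RF (inj₂ _) (inj₂ _) = ⊥

  RF? : ∀ u w → Dec (RF u w)
  RF? (inj₁ x) (inj₁ y) = Finite.any? fin-Bool λ c → Finite.any? fin-Bool λ f → Edge? Q c f x y
  RF? (inj₁ x) (inj₂ w) = Finₚ.any? λ i → Finₚ.any? λ j → Finite._≟′_ (finite Q) _ _
  RF? (inj₂ w) (inj₁ x) = Finₚ.any? λ i → Finₚ.any? λ j → Finite._≟′_ (finite Q) _ _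
  RF? (inj₂ _) (inj₂ _) = no λ ()

  RF-sym : ∀ {u w} → RF u w → RF w u
  RF-sym {inj₁ _} {inj₁ _} (c , f , E) = c , f , Edge-sym Q E
  RF-sym {inj₁ _} {inj₂ _} r = r
  RF-sym {inj₂ _} {inj₁ _} r = r

  RF-irreflexive : ∀ {u} → ¬ RF u u
  RF-irreflexive {inj₁ _} (c , f , E) = Edge-part Q E refl

  Coloured : {V : Set} → (V → V → Set) → (V → V → Bool) → Bool → V → V → Set
  Coloured R χ b u w = R u w × χ u w ≡ b

  opaque
    red? : ∀ x y → Dec (Mono Q true x y)
    red? x y = Finite.any? fin-Bool λ f → Edge? Q true f x y

  red-edge : V Q → V Q → Bool
  red-edge x y = does (red? x y)

  red-edge-mono : ∀ {b x y} → (∃ λ c → ∃ λ f → Edge Q c f x y) → red-edge x y ≡ b → Mono Q b x y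
  red-edge-mono {x = x} {y} (c , f , E) eq with red? x y
  red-edge-mono _ refl | yes red = red
  red-edge-mono (true  , E) refl | no ¬red = ⊥-elim (¬red E)
  red-edge-mono (false , E) refl | no ¬red = E

  red-edge-sym : ∀ x y → red-edge x y ≡ red-edge y x
  red-edge-sym x y with red? x y | red? y x
  ... | yes _ | yes _ = refl
  ... | no _  | no _  = refl
  ... | yes (f , E) | no ¬red = ⊥-elim (¬red (f , Edge-sym Q E))
  ... | no ¬red | yes (f , E) = ⊥-elim (¬red (f , Edge-sym Q E))

  -- Every colouring of the large graph has a monochromatic H

  module Arrow (χ : VF → VF → Bool) (χ-sym : ∀ u w → χ u w ≡ χ w u)
               (free : ∀ b → ¬ HCopy (Coloured RF χ b)) where

    forced = Q-forced (λ x y → χ (inj₁ x) (inj₁ y)) (λ x y → χ-sym _ _)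
    ε = proj₁ forced
    γ : Bool → Bool
    γ = proj₁ (proj₂ forced)

    place : Vᵖ → VF
    place = inj₁ ∘ ι ε

    place-injective : ∀ {u w} → place u ≡ place w → u ≡ w
    place-injective eq = injective ε (inj₁-injective eq)

    C : Bool → VF → VF → Set
    C = Coloured RF χ

    C-sym : ∀ {b u w} → C b u w → C b w u
    C-sym {u = u} {w} (r , eq) = RF-sym {u} {w} r , trans (χ-sym w u) eq

    active : ∀ {c u w} → Edgeᵖ c true u w → C (γ c) (place u) (place w)
    active {c} {u} {w} E = (c , true , edge ε E) , proj₂ (proj₂ forced) {c} {u} {w} E

    skel : Skeleton → VF
    skel = place ∘ inj₁

    skel-edge : ∀ {c u w} → D c u w → RF (skel u) (skel w)
    skel-edge {c} Du = c , false , edge ε Du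

    skel-injective : ∀ {u w} → skel u ≡ skel w → u ≡ w
    skel-injective eq with place-injective eq
    ... | refl = refl

    gadget-forces : ∀ {c u w} → D c u w → χ (skel u) (skel w) ≢ γ (not c)
    gadget-forces {c} {u} {w} Du eq = free (γ (not c)) (record
      { κ = place ∘ G ; v = place apex ; clique = λ {i} {j} → clique {i} {j} ; apex = apex-edge
      ; fresh = λ i eq → fresh i (place-injective eq) })
      where
      D² : D (not (not c)) u w
      D² = subst (λ c → D c u w) (sym (Boolₚ.not-involutive c)) Du

      G : I → Vᵖ
      G (inj₁ zero)          = inj₁ u
      G (inj₁ (suc zero))    = inj₁ w
      G (inj₁ (suc (suc m))) = inj₂ (u , w , inj₁ m , false)
      G (inj₂ k)             = inj₂ (u , w , inj₂ k , false)

      -- The twin of the vertex `G i₂`. The twins are not joined, but H does not ask for this, since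
      -- `i₂` is not among the d neighbours of the apex.
      apex : Vᵖ
      apex = inj₂ (u , w , inj₂ zero , true)

      fresh : ∀ i → apex ≢ G i
      fresh (inj₁ (suc (suc m))) ()
      fresh (inj₂ k) ()

      lift : ∀ {a b} → Edgeᵖ (not c) true a b → C (γ (not c)) (place a) (place b)
      lift = active

      clique : Clique (C (γ (not c))) (place ∘ G)
      clique {inj₁ zero}          {inj₁ zero}          i≢ = ⊥-elim (i≢ refl)
      clique {inj₁ zero}          {inj₁ (suc zero)}    i≢ = skel-edge Du , eq
      clique {inj₁ zero}          {inj₁ (suc (suc _))} i≢ = lift (D² , inj₁ refl)
      clique {inj₁ zero}          {inj₂ _}             i≢ = lift (D² , inj₁ refl)
      clique {inj₁ (suc zero)}    {inj₁ zero}          i≢ = C-sym {u = skel u} {skel w} (skel-edge Du , eq)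
      clique {inj₁ (suc zero)}    {inj₁ (suc zero)}    i≢ = ⊥-elim (i≢ refl)
      clique {inj₁ (suc zero)}    {inj₁ (suc (suc _))} i≢ = lift (D² , inj₂ refl)
      clique {inj₁ (suc zero)}    {inj₂ _}             i≢ = lift (D² , inj₂ refl)
      clique {inj₁ (suc (suc _))} {inj₁ zero}          i≢ = lift (D² , inj₁ refl)
      clique {inj₁ (suc (suc _))} {inj₁ (suc zero)}    i≢ = lift (D² , inj₂ refl)
      clique {inj₁ (suc (suc _))} {inj₁ (suc (suc _))} i≢ = lift (D² , refl , refl , λ { refl → i≢ refl })
      clique {inj₁ (suc (suc _))} {inj₂ _}             i≢ = lift (D² , refl , refl , λ ())
      clique {inj₂ _}             {inj₁ zero}          i≢ = lift (D² , inj₁ refl)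
      clique {inj₂ _}             {inj₁ (suc zero)}    i≢ = lift (D² , inj₂ refl)
      clique {inj₂ _}             {inj₁ (suc (suc _))} i≢ = lift (D² , refl , refl , λ ())
      clique {inj₂ _}             {inj₂ _}             i≢ = lift (D² , refl , refl , λ { refl → i≢ refl })

      apex-edge : ∀ i → C (γ (not c)) (place apex) (place (G (inj₁ i)))
      apex-edge zero          = lift (D² , inj₁ refl)
      apex-edge (suc zero)    = lift (D² , inj₂ refl)
      apex-edge (suc (suc _)) = lift (D² , refl , refl , λ ())

    skel-colour : ∀ {c u w} → D c u w → χ (skel u) (skel w) ≡ not (γ (not c))
    skel-colour Du = Boolₚ.¬-not (gadget-forces Du)

    -- Otherwise all skeleton edges would have one colour. A core vertex off a transversal is joined
    -- to all its d core vertices, by a red edge in its own row and by blue ones in the others, and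
    -- so would be an apex for the block.
    colours-differ : γ true ≢ γ false
    colours-differ γ≡ = free (not (γ true)) (record
      { κ = skel ∘ block T₀ ; v = skel v₀ ; clique = λ i≢j → mono (block-clique T₀ i≢j)
      ; apex = apex ; fresh = λ i eq → fresh i (skel-injective eq) })
      where
      T₀ : Vec (Fin d) d
      T₀ = zero ∷ Vec.replicate _ zero

      v₀ : Skeleton
      v₀ = core zero (suc zero)

      fresh : ∀ i → v₀ ≢ block T₀ i
      fresh (inj₁ zero) ()
      fresh (inj₁ (suc _)) ()
      fresh (inj₂ _) ()

      γ-const : ∀ c → γ c ≡ γ true
      γ-const true  = refl
      γ-const false = sym γ≡

      mono : ∀ {c u w} → D c u w → C (not (γ true)) (skel u) (skel w)
      mono {c} Du = skel-edge Du , trans (skel-colour Du) (cong not (γ-const (not c)))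

      apex : ∀ i → C (not (γ true)) (skel v₀) (skel (block T₀ (inj₁ i)))
      apex zero    = mono {true} (refl , λ ())
      apex (suc i) = mono {false} λ ()

    γ-not : ∀ c → γ c ≡ not (γ (not c))
    γ-not true  = Boolₚ.¬-not colours-differ
    γ-not false = Boolₚ.¬-not (colours-differ ∘ sym)

    skel-mono : ∀ {c u w} → D c u w → C (γ c) (skel u) (skel w)
    skel-mono {c} Du = skel-edge Du , trans (skel-colour Du) (sym (γ-not c))

    core-image : Fin d → Fin d → V Q
    core-image i j = ι ε (inj₁ (core i j))

    W : VF
    W = inj₂ (Vec.tabulate λ i → Vec.tabulate (core-image i))

    W-edge : ∀ i j → RF W (skel (core i j))
    W-edge i j = i , j , trans (cong (λ r → Vec.lookup r j) (Vecₚ.lookup∘tabulate (λ i → Vec.tabulate (core-image i)) i))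
      (Vecₚ.lookup∘tabulate (core-image i) j)

    blue-in-row : ∀ i → ∃ λ j → χ W (skel (core i j)) ≡ γ false
    blue-in-row i with Finₚ.any? (λ j → χ W (skel (core i j)) Boolₚ.≟ γ false)
    ... | yes found = found
    ... | no none   = ⊥-elim (free (γ true) (record
      { κ = skel ∘ row i ; v = W ; clique = λ i≢j → skel-mono (row-clique i i≢j)
      ; apex = λ j → W-edge i j , trans (Boolₚ.¬-not (λ eq → none (j , eq))) (sym (γ-not true)) ; fresh = λ _ () }))

    impossible : ⊥
    impossible = free (γ false) (record
      { κ = skel ∘ block T ; v = W ; clique = λ i≢j → skel-mono (block-clique T i≢j)
      ; apex = λ i → W-edge i _ , blue i
      ; fresh = λ _ () })
      where
      T : Vec (Fin d) d
      T = Vec.tabulate (proj₁ ∘ blue-in-row)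
      blue : ∀ i → χ W (skel (core i (Vec.lookup T i))) ≡ γ false
      blue i = trans (cong (λ j → χ W (skel (core i j))) (Vecₚ.lookup∘tabulate (proj₁ ∘ blue-in-row) i)) (proj₂ (blue-in-row i))

  -- Copies of H in graphs, and the lower bound

  t : ℕ
  t = d + e

  K : Graph
  K = H t d

  enc : Maybe I → Fin (suc t)
  enc nothing  = Fin.fromℕ t
  enc (just i) = Fin.inject₁ (Fin.join d e i)

  decode : (x : Fin (suc t)) → ∃ λ m → enc m ≡ x
  decode x with view x
  ... | ‵fromℕ        = nothing , refl
  ... | ‵inj₁ {i = i} _ = just (Fin.splitAt d i) , cong Fin.inject₁ (Finₚ.join-splitAt d e i)

  dec : Fin (suc t) → Maybe I
  dec x = proj₁ (decode x)

  enc-dec : ∀ x → enc (dec x) ≡ x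
  enc-dec x = proj₂ (decode x)

  dec-injective : ∀ {x y} → dec x ≡ dec y → x ≡ y
  dec-injective eq = trans (sym (enc-dec _)) (trans (cong enc eq) (enc-dec _))

  join-injective : ∀ {i j} → Fin.join d e i ≡ Fin.join d e j → i ≡ j
  join-injective {i} {j} eq =
    trans (sym (Finₚ.splitAt-join d e i)) (trans (cong (Fin.splitAt d) eq) (Finₚ.splitAt-join d e j))

  enc-injective : ∀ {m m′} → enc m ≡ enc m′ → m ≡ m′
  enc-injective = maybe-injective {f = enc} (join-injective ∘ Finₚ.inject₁-injective) (λ i → Finₚ.fromℕ≢inject₁)

  data HEdge : Maybe I → Maybe I → Set where
    clique : ∀ {i j} → i ≢ j → HEdge (just i) (just j)
    apexˡ  : ∀ i → HEdge nothing (just (inj₁ i))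
    apexʳ  : ∀ i → HEdge (just (inj₁ i)) nothing

  HEdge-sym : ∀ {m m′} → HEdge m m′ → HEdge m′ m
  HEdge-sym (clique i≢j) = clique (i≢j ∘ sym)
  HEdge-sym (apexˡ i)    = apexʳ i
  HEdge-sym (apexʳ i)    = apexˡ i

  adjacent : ℕ → ℕ → Bool
  adjacent a b = ((a <ᵇ t) ∧ (b <ᵇ t)) ∨ ((a ≡ᵇ t) ∧ (b <ᵇ d))

  K-edge : ∀ x y → E K x y ≡ not ⌊ x ≟ y ⌋ ∧ (adjacent (toℕ x) (toℕ y) ∨ adjacent (toℕ y) (toℕ x))
  K-edge x y = refl

  Adjacent : ℕ → ℕ → Set
  Adjacent a b = (a < t × b < t) ⊎ (a ≡ t × b < d)

  ≡true⇒True : ∀ {b} → b ≡ true → True b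
  ≡true⇒True = Equivalence.from Boolₚ.T-≡

  True⇒≡true : ∀ {b} → True b → b ≡ true
  True⇒≡true = Equivalence.to Boolₚ.T-≡

  adjacent⇒Adjacent : ∀ a b → True (adjacent a b) → Adjacent a b
  adjacent⇒Adjacent a b adj = Sum.map
    (λ p → let (p₁ , p₂) = Equivalence.to (Boolₚ.T-∧ {a <ᵇ t}) p in ℕₚ.<ᵇ⇒< a t p₁ , ℕₚ.<ᵇ⇒< b t p₂)
    (λ p → let (p₁ , p₂) = Equivalence.to (Boolₚ.T-∧ {a ≡ᵇ t}) p in ℕₚ.≡ᵇ⇒≡ a t p₁ , ℕₚ.<ᵇ⇒< b d p₂)
    (Equivalence.to (Boolₚ.T-∨ {(a <ᵇ t) ∧ (b <ᵇ t)}) adj)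

  Adjacent⇒adjacent : ∀ a b → Adjacent a b → True (adjacent a b)
  Adjacent⇒adjacent a b adj = Equivalence.from (Boolₚ.T-∨ {(a <ᵇ t) ∧ (b <ᵇ t)}) (Sum.map
    (λ (p₁ , p₂) → Equivalence.from (Boolₚ.T-∧ {a <ᵇ t}) (ℕₚ.<⇒<ᵇ p₁ , ℕₚ.<⇒<ᵇ p₂))
    (λ (p₁ , p₂) → Equivalence.from (Boolₚ.T-∧ {a ≡ᵇ t}) (ℕₚ.≡⇒≡ᵇ a t p₁ , ℕₚ.<⇒<ᵇ p₂)) adj)

  K-edge⇒ : ∀ x y → E K x y ≡ true → x ≢ y × (Adjacent (toℕ x) (toℕ y) ⊎ Adjacent (toℕ y) (toℕ x))
  K-edge⇒ x y eq with x ≟ y | ≡true⇒True (trans (sym (K-edge x y)) eq)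
  ... | no x≢y | adj = x≢y , Sum.map (adjacent⇒Adjacent _ _) (adjacent⇒Adjacent _ _)
    (Equivalence.to (Boolₚ.T-∨ {adjacent (toℕ x) (toℕ y)}) adj)

  K-edge⇐ : ∀ x y → x ≢ y → Adjacent (toℕ x) (toℕ y) ⊎ Adjacent (toℕ y) (toℕ x) → E K x y ≡ true
  K-edge⇐ x y x≢y adj = trans (K-edge x y) (decided (x ≟ y))
    where
    decided : (x≟y : Dec (x ≡ y)) → not ⌊ x≟y ⌋ ∧ (adjacent (toℕ x) (toℕ y) ∨ adjacent (toℕ y) (toℕ x)) ≡ true
    decided (yes x≡y) = ⊥-elim (x≢y x≡y)
    decided (no _)    = True⇒≡true (Equivalence.from (Boolₚ.T-∨ {adjacent (toℕ x) (toℕ y)})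
      (Sum.map (Adjacent⇒adjacent (toℕ x) (toℕ y)) (Adjacent⇒adjacent (toℕ y) (toℕ x)) adj))

  enc-just : ∀ i → toℕ (enc (just i)) < t
  enc-just i = subst (_< t) (sym (Finₚ.toℕ-inject₁ (Fin.join d e i))) (Finₚ.toℕ<n (Fin.join d e i))

  enc-nothing : toℕ (enc nothing) ≡ t
  enc-nothing = Finₚ.toℕ-fromℕ t

  enc-left : ∀ i → toℕ (enc (just (inj₁ i))) < d
  enc-left i = subst (_< d) (sym (trans (Finₚ.toℕ-inject₁ (i Fin.↑ˡ e)) (Finₚ.toℕ-↑ˡ i e))) (Finₚ.toℕ<n i)

  enc-right : ∀ k → ¬ toℕ (enc (just (inj₂ k))) < d
  enc-right k <d = ℕₚ.<⇒≱ (subst (_< d) (trans (Finₚ.toℕ-inject₁ (d Fin.↑ʳ k)) (Finₚ.toℕ-↑ʳ d k)) <d) (ℕₚ.m≤m+n d (toℕ k))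

  nothing≮t : ¬ toℕ (enc nothing) < t
  nothing≮t = ℕₚ.<-irrefl enc-nothing

  apex-edge⇒ : ∀ i → E K (enc nothing) (enc (just i)) ≡ true → HEdge nothing (just i)
  apex-edge⇒ (inj₁ i) _ = apexˡ i
  apex-edge⇒ (inj₂ k) eq with proj₂ (K-edge⇒ (enc nothing) (enc (just (inj₂ k))) eq)
  ... | inj₁ (inj₁ (n<t , _))  = ⊥-elim (nothing≮t n<t)
  ... | inj₁ (inj₂ (_ , k<d))  = ⊥-elim (enc-right k k<d)
  ... | inj₂ (inj₁ (_ , n<t))  = ⊥-elim (nothing≮t n<t)
  ... | inj₂ (inj₂ (k≡t , _))  = ⊥-elim (ℕₚ.<-irrefl k≡t (enc-just (inj₂ k)))

  enc-edge⇒ : ∀ m m′ → E K (enc m) (enc m′) ≡ true → HEdge m m′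
  enc-edge⇒ nothing  nothing  eq = ⊥-elim (proj₁ (K-edge⇒ (enc nothing) (enc nothing) eq) refl)
  enc-edge⇒ nothing  (just i) eq = apex-edge⇒ i eq
  enc-edge⇒ (just i) nothing  eq = HEdge-sym (apex-edge⇒ i (trans (symE K (enc nothing) (enc (just i))) eq))
  enc-edge⇒ (just i) (just j) eq = clique (proj₁ (K-edge⇒ (enc (just i)) (enc (just j)) eq) ∘ cong (enc ∘ just))

  HEdge-irreflexive : ∀ {m} → ¬ HEdge m m
  HEdge-irreflexive (clique i≢i) = i≢i refl

  enc-edge⇐ : ∀ {m m′} → HEdge m m′ → E K (enc m) (enc m′) ≡ true
  enc-edge⇐ {m} {m′} h = K-edge⇐ (enc m) (enc m′) (λ eq → irreflexive (enc-injective {m} {m′} eq) h) (adj h)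
    where
    irreflexive : ∀ {m m′} → m ≡ m′ → ¬ HEdge m m′
    irreflexive refl = HEdge-irreflexive
    adj : ∀ {m m′} → HEdge m m′ → Adjacent (toℕ (enc m)) (toℕ (enc m′)) ⊎ Adjacent (toℕ (enc m′)) (toℕ (enc m))
    adj (clique {i} {j} _) = inj₁ (inj₁ (enc-just i , enc-just j))
    adj (apexˡ i)          = inj₁ (inj₂ (enc-nothing , enc-left i))
    adj (apexʳ i)          = inj₂ (inj₂ (enc-nothing , enc-left i))

  module _ {V : Set} {R : V → V → Set} (R-sym : ∀ {u w} → R u w → R w u) (R-irr : ∀ {u} → ¬ R u u) (h : HCopy R) where

    open HCopy h using (κ; v; apex; fresh)

    vertex : Maybe I → V
    vertex nothing  = v
    vertex (just i) = κ i

    vertex-edge : ∀ {m m′} → HEdge m m′ → R (vertex m) (vertex m′)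
    vertex-edge (clique i≢j) = HCopy.clique h i≢j
    vertex-edge (apexˡ i)    = apex i
    vertex-edge (apexʳ i)    = R-sym (apex i)

    vertex-injective : ∀ {m m′} → vertex m ≡ vertex m′ → m ≡ m′
    vertex-injective = maybe-injective {f = vertex}
      (clique-injective {R = R} id (λ { Ruw refl → R-irr Ruw }) (HCopy.clique h)) fresh

  HCopy-map : ∀ {V V′ : Set} {R : V → V → Set} {R′ : V′ → V′ → Set} (f : V → V′) → (∀ {x y} → f x ≡ f y → x ≡ y) →
              (∀ {x y} → R x y → R′ (f x) (f y)) → HCopy R → HCopy R′
  HCopy-map f inj edge h = record
    { κ = f ∘ κ ; v = f v ; clique = edge ∘ HCopy.clique h ; apex = edge ∘ apex ; fresh = λ i → fresh i ∘ inj }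
    where open HCopy h using (κ; v; apex; fresh)

  Edgeᵍ : (F : Graph) → Fin (n F) → Fin (n F) → Set
  Edgeᵍ F i j = E F i j ≡ true

  module _ (F : Graph) (c : Fin (n F) → Fin (n F) → Bool) where

    private
      CF : Bool → Fin (n F) → Fin (n F) → Set
      CF = Coloured (Edgeᵍ F) c

    CF-irreflexive : ∀ {b i} → ¬ CF b i i
    CF-irreflexive {b} {i} (Eii , _) with trans (sym Eii) (irr F i)
    ... | ()

    CF-sym : (∀ i j → c i j ≡ c j i) → ∀ {b i j} → CF b i j → CF b j i
    CF-sym c-sym (Eij , cij) = trans (symE F _ _) Eij , trans (c-sym _ _) cij

    monoCopy⇒HCopy : ∀ {b} → MonoCopy F K c b → HCopy (CF b)
    monoCopy⇒HCopy {b} (f , (inj , edge) , mono) = record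
      { κ      = f ∘ enc ∘ just
      ; v      = f (enc nothing)
      ; clique = λ i≢j → image (clique i≢j)
      ; apex   = λ i → image (apexˡ i)
      ; fresh  = λ i eq → distinct (enc-injective {nothing} {just i} (inj eq)) }
      where
      image : ∀ {m m′} → HEdge m m′ → CF b (f (enc m)) (f (enc m′))
      image h = edge _ _ (enc-edge⇐ h) , mono _ _ (enc-edge⇐ h)
      distinct : ∀ {i : I} → nothing ≢ just i
      distinct ()

    HCopy⇒monoCopy : ∀ {b} → (∀ i j → c i j ≡ c j i) → HCopy (CF b) → MonoCopy F K c b
    HCopy⇒monoCopy {b} c-sym h = place , (dec-injective ∘ vertex-injective (CF-sym c-sym) CF-irreflexive h ,
      λ i j → proj₁ ∘ image i j) , λ i j → proj₂ ∘ image i j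
      where
      place : Fin (suc t) → Fin (n F)
      place = vertex (CF-sym c-sym) CF-irreflexive h ∘ dec
      image : ∀ i j → E K i j ≡ true → CF b (place i) (place j)
      image i j Eij = vertex-edge (CF-sym c-sym) CF-irreflexive h
        (enc-edge⇒ (dec i) (dec j) (subst₂ (λ x y → E K x y ≡ true) (sym (enc-dec i)) (sym (enc-dec j)) Eij))

  nbr-clique : ∀ m → ∃ λ (δ : Fin d → Maybe I) → (∀ j → HEdge m (δ j)) × (∀ {j j′} → j ≢ j′ → HEdge (δ j) (δ j′))
  nbr-clique nothing = just ∘ inj₁ , apexˡ , λ j≢ → clique λ { refl → j≢ refl }
  nbr-clique (just (inj₂ k)) = just ∘ inj₁ , (λ j → clique λ ()) , λ j≢ → clique λ { refl → j≢ refl }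
  nbr-clique (just (inj₁ i)) = just ∘ δ , (λ j → clique (avoids j)) , λ j≢ → clique (j≢ ∘ δ-injective _ _)
    where
    -- The vertex itself is not its own neighbour; `i₂` takes its place in the `K_d`.
    δ : Fin d → I
    δ j with i ≟ j
    ... | yes _ = i₂
    ... | no _  = inj₁ j
    avoids : ∀ j → inj₁ i ≢ δ j
    avoids j eq with i ≟ j
    avoids j () | yes _
    avoids j refl | no i≢i = i≢i refl
    δ-injective : ∀ j j′ → δ j ≡ δ j′ → j ≡ j′
    δ-injective j j′ eq with i ≟ j | i ≟ j′
    δ-injective j j′ eq   | yes i≡j | yes i≡j′ = trans (sym i≡j) i≡j′
    δ-injective j j′ ()   | yes _   | no _
    δ-injective j j′ ()   | no _    | yes _
    δ-injective j j′ refl | no _    | no _ = refl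

  -- The lower bound: greedy cliques around a vertex of small degree

  module Greedy {m : ℕ} (R : Fin m → Fin m → Set) (R? : ∀ i j → Dec (R i j)) (R-irr : ∀ {i} → ¬ R i i) where

    RClique : (Fin d → Fin m) → Set
    RClique C = ∀ i j → i ≢ j → R (C i) (C j)

    record Family (k : ℕ) (L : List (Fin m)) : Set where
      field
        size    : ℕ
        few     : size < k
        member  : Fin size → Fin d → Fin m
        cliques : ∀ i → RClique (member i)
        meets   : ∀ C → RClique C → (∀ j → C j ∈ L) → ∃ λ j → ∃ λ a → ∃ λ b → member a b ≡ C j

    InList : List (Fin m) → (Fin d → Fin m) → Set
    InList L C = RClique C × (∀ j → C j ∈ L)

    inList? : ∀ L → Dec (∃ (InList L))
    inList? L = anyFun? fin-Fin resp (λ C →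
      (Finₚ.all? λ i → Finₚ.all? λ j → ¬? (i ≟ j) →-dec R? (C i) (C j)) ×-dec Finₚ.all? λ j → Any.any? (C j ≟_) L)
      where
      resp : ∀ {C C′} → (∀ i → C i ≡ C′ i) → InList L C → InList L C′
      resp C≗ (cl , C⊆) = (λ i j i≢j → subst₂ R (C≗ i) (C≗ j) (cl i j i≢j)) , λ j → subst (_∈ L) (C≗ j) (C⊆ j)

    module Remove {k : ℕ} {L : List (Fin m)} (unique : Unique L) (short : length L < suc k * d)
                  (C : Fin d → Fin m) (cl : RClique C) (C⊆ : ∀ j → C j ∈ L) where

      hit? : ∀ x → Dec (∃ λ b → C b ≡ x)
      hit? x = Finₚ.any? λ b → C b ≟ x

      rest : List (Fin m)
      rest = filter (¬? ∘ hit?) L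

      rest-unique : Unique rest
      rest-unique = Uniqueₚ.filter⁺ (¬? ∘ hit?) unique

      C-injective : ∀ {i j} → C i ≡ C j → i ≡ j
      C-injective {i} {j} eq with i ≟ j
      ... | yes i≡j = i≡j
      ... | no i≢j  = ⊥-elim (R-irr (subst (R (C i)) (sym eq) (cl i j i≢j)))

      both : List (Fin m)
      both = List.tabulate C List.++ rest

      both-length : length both ≡ d + length rest
      both-length = trans (Listₚ.length-++ (List.tabulate C)) (cong (_+ length rest) (Listₚ.length-tabulate C))

      both-unique : Unique both
      both-unique = Uniqueₚ.++⁺ (Uniqueₚ.tabulate⁺ C-injective) rest-unique disjoint
        where
        disjoint : ∀ {x} → ¬ (x ∈ List.tabulate C × x ∈ rest)
        disjoint (x∈C , x∈rest) with ∈ₚ.∈-tabulate⁻ {f = C} x∈C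
        ... | j , refl = proj₂ (∈ₚ.∈-filter⁻ (¬? ∘ hit?) {xs = L} x∈rest) (j , refl)

      both-⊆ : ∀ {x} → x ∈ both → x ∈ L
      both-⊆ = [ inTab , proj₁ ∘ ∈ₚ.∈-filter⁻ (¬? ∘ hit?) ]′ ∘ ∈ₚ.∈-++⁻ (List.tabulate C)
        where
        inTab : ∀ {x} → x ∈ List.tabulate C → x ∈ L
        inTab x∈ with ∈ₚ.∈-tabulate⁻ {f = C} x∈
        ... | j , refl = C⊆ j

      rest-short : length rest < k * d
      rest-short = ℕₚ.+-cancelˡ-< d (length rest) (k * d)
        (ℕₚ.≤-<-trans (subst (_≤ length L) both-length (Unique-⊆-length both-unique both-⊆)) short)

      add : Family k rest → Family (suc k) L
      add family = record
        { size = suc size ; few = s≤s few ; member = member⁺ ; cliques = cliques⁺ ; meets = meets⁺ }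
        where
        open Family family
        member⁺ : Fin (suc size) → Fin d → Fin m
        member⁺ zero    = C
        member⁺ (suc i) = member i

        cliques⁺ : ∀ i → RClique (member⁺ i)
        cliques⁺ zero    = cl
        cliques⁺ (suc i) = cliques i

        meets⁺ : ∀ C′ → RClique C′ → (∀ j → C′ j ∈ L) → ∃ λ j → ∃ λ a → ∃ λ b → member⁺ a b ≡ C′ j
        meets⁺ C′ cl′ C′⊆ with Finₚ.any? (λ j → hit? (C′ j))
        ... | yes (j , b , eq) = j , zero , b , eq
        ... | no miss with meets C′ cl′ (λ j → ∈ₚ.∈-filter⁺ (¬? ∘ hit?) (C′⊆ j) (λ hit → miss (j , hit)))
        ...   | j , a , b , eq = j , suc a , b , eq

    -- Every chosen clique removes d vertices from a list of fewer than `k * d`, so the choice stops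
    -- before `k` cliques are reached.
    greedy : ∀ k L → Unique L → length L < k * d → Family k L
    greedy (suc k) L unique short = continue (inList? L)
      where
      continue : Dec (∃ (InList L)) → Family (suc k) L
      continue (no none) = record { size = 0 ; few = s≤s z≤n ; member = λ () ; cliques = λ ()
                                  ; meets = λ C cl C⊆ → ⊥-elim (none (C , cl , C⊆)) }
      continue (yes (C , cl , C⊆)) = add (greedy k rest rest-unique rest-short)
        where open Remove {k} unique short C cl C⊆

  module LowerBound (F : Graph) (v : Fin (n F)) (small : deg F v < d * d) where

    F⁻ : Graph
    F⁻ = delVertex F v

    module _ (c : Fin (n F⁻) → Fin (n F⁻) → Bool) (c-sym : ∀ i j → c i j ≡ c j i) where

      out : ∀ {x} → v ≢ x → Fin (n F⁻)
      out v≢x = proj₁ (inclusion-onto F v v≢x)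

      base : Fin (n F) → Fin (n F) → Bool
      base x y with v ≟ x | v ≟ y
      ... | no v≢x | no v≢y = c (out v≢x) (out v≢y)
      -- A dummy value for pairs containing `v`: the red cliques are sought among the neighbours of
      -- `v`, and `col` paints the edges at `v` anew.
      ... | _      | _      = true

      base-sym : ∀ x y → base x y ≡ base y x
      base-sym x y with v ≟ x | v ≟ y
      ... | no v≢x | no v≢y = c-sym _ _
      ... | no _   | yes _  = refl
      ... | yes _  | no _   = refl
      ... | yes _  | yes _  = refl

      base-inclusion : ∀ i j → base (inclusion F v i) (inclusion F v j) ≡ c i j
      base-inclusion i j with v ≟ inclusion F v i | v ≟ inclusion F v j
      ... | yes eq | _      = ⊥-elim (inclusion-avoids F v i (sym eq))
      ... | no _   | yes eq = ⊥-elim (inclusion-avoids F v j (sym eq))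
      ... | no v≢i | no v≢j = cong₂ c (back v≢i) (back v≢j)
        where
        back : ∀ {i} (v≢ : v ≢ inclusion F v i) → out v≢ ≡ i
        back v≢ = proj₁ (inclusion-copy F v) (proj₂ (inclusion-onto F v v≢))

      Red : Fin (n F) → Fin (n F) → Set
      Red = Coloured (Edgeᵍ F) base true

      open Greedy Red (λ i j → (E F i j Boolₚ.≟ true) ×-dec (base i j Boolₚ.≟ true)) (CF-irreflexive F base)

      opaque
       family : Family d (neighbours F v)
       family = greedy d (neighbours F v) (neighbours-unique F v) (subst (_< d * d) (deg-neighbours F v) small)
      open Family family

      covered? : ∀ x → Dec (∃ λ a → ∃ λ b → member a b ≡ x)
      covered? x = Finₚ.any? λ a → Finₚ.any? λ b → member a b ≟ x

      spoke : Fin (n F) → Bool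
      spoke x = not (does (covered? x))

      paint : ∀ {x y} → Dec (v ≡ x) → Dec (v ≡ y) → Bool
      paint {y = y} (yes _) _       = spoke y
      paint {x = x} (no _)  (yes _) = spoke x
      paint {x} {y} (no _)  (no _)  = base x y

      col : Fin (n F) → Fin (n F) → Bool
      col x y = paint (v ≟ x) (v ≟ y)

      col-sym : ∀ x y → col x y ≡ col y x
      col-sym x y = paint-sym (v ≟ x) (v ≟ y)
        where
        paint-sym : ∀ (r : Dec (v ≡ x)) (r′ : Dec (v ≡ y)) → paint r r′ ≡ paint r′ r
        paint-sym (yes refl) (yes refl) = refl
        paint-sym (yes _)    (no _)     = refl
        paint-sym (no _)     (yes _)    = refl
        paint-sym (no _)     (no _)     = base-sym x y

      col-spoke : ∀ y → col v y ≡ spoke y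
      col-spoke y with v ≟ v
      ... | yes _  = refl
      ... | no v≢v = ⊥-elim (v≢v refl)

      col-base : ∀ {x y} → v ≢ x → v ≢ y → col x y ≡ base x y
      col-base {x} {y} v≢x v≢y = paint-base (v ≟ x) (v ≟ y)
        where
        paint-base : ∀ (r : Dec (v ≡ x)) (r′ : Dec (v ≡ y)) → paint r r′ ≡ base x y
        paint-base (yes v≡x) _         = ⊥-elim (v≢x v≡x)
        paint-base (no _)    (yes v≡y) = ⊥-elim (v≢y v≡y)
        paint-base (no _)    (no _)    = refl

      CC : Bool → Fin (n F) → Fin (n F) → Set
      CC = Coloured (Edgeᵍ F) col

      no-nbr-clique : ∀ b (u : Fin d → Fin (n F)) → (∀ j → CC b v (u j)) → (∀ {j j′} → j ≢ j′ → CC b (u j) (u j′)) → ⊥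
      no-nbr-clique b u spokes clq = excluded b refl
        where
        v≢u : ∀ j → v ≢ u j
        v≢u j v≡ = CF-irreflexive F col (subst (CC b v) (sym v≡) (spokes j))

        on-base : ∀ {j j′} → j ≢ j′ → Coloured (Edgeᵍ F) base b (u j) (u j′)
        on-base {j} {j′} j≢ = proj₁ (clq j≢) , trans (sym (col-base (v≢u j) (v≢u j′))) (proj₂ (clq j≢))

        spoke-colour : ∀ j → spoke (u j) ≡ b
        spoke-colour j = trans (sym (col-spoke (u j))) (proj₂ (spokes j))

        covered : ∀ j → b ≡ false → ∃ λ a → ∃ λ b → member a b ≡ u j
        covered j b≡ with covered? (u j) | trans (spoke-colour j) b≡
        ... | yes cov | _ = cov

        excluded : ∀ b′ → b ≡ b′ → ⊥
        excluded true refl with meets u (λ _ _ → on-base) (λ j → ∈-neighbours F v (proj₁ (spokes j)))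
        ... | j , a , b , eq with covered? (u j) | spoke-colour j
        ...   | no ¬cov | _ = ¬cov (a , b , eq)
        ...   | yes _   | ()
        excluded false refl with Finₚ.pigeonhole few (λ j → proj₁ (covered j refl))
        ... | j , j′ , j<j′ , same = clash (proj₂ (covered j refl)) (subst (λ a → ∃ λ b → member a b ≡ u j′) (sym same) (proj₂ (covered j′ refl)))
          where
          j≢j′ : j ≢ j′
          j≢j′ = Finₚ.<⇒≢ j<j′
          clash : ∀ {a} → (∃ λ b → member a b ≡ u j) → (∃ λ b → member a b ≡ u j′) → ⊥
          clash {a} (b , eq) (b′ , eq′) with b ≟ b′
          ... | yes refl = CF-irreflexive F col (subst (CC false (u j)) (trans (sym eq′) eq) (clq j≢j′))
          ... | no b≢b′ with trans (sym (proj₂ (subst₂ Red eq eq′ (cliques a b b′ b≢b′)))) (proj₂ (on-base j≢j′))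
          ...   | ()

      -- The lower bound in positive form: an arbitrary colouring of F - v is extended to F, and the
      -- monochromatic copy found there must avoid `v`. So F - v has the Ramsey property already,
      -- which contradicts minimality.
      extend : Arrows F K → ∃ (MonoCopy F⁻ K c)
      extend arr with arr (col , col-sym)
      ... | b , copy with monoCopy⇒HCopy F col copy
      ...   | h with Finite.any? (fin-Maybe fin-I) (λ m → vertex (CF-sym F col col-sym) (CF-irreflexive F col) h m ≟ v)
      ...     | yes (m , at-v) = ⊥-elim (no-nbr-clique b (vx ∘ δ) (λ j → subst (λ x → CC b x (vx (δ j))) at-v (vx-edge (proj₁ (proj₂ nbrs) j)))
                                    (λ j≢ → vx-edge (proj₂ (proj₂ nbrs) j≢)))
        where
        nbrs = nbr-clique m
        δ = proj₁ nbrs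
        vx : Maybe I → Fin (n F)
        vx = vertex (CF-sym F col col-sym) (CF-irreflexive F col) h
        vx-edge : ∀ {m m′} → HEdge m m′ → CC b (vx m) (vx m′)
        vx-edge = vertex-edge (CF-sym F col col-sym) (CF-irreflexive F col) h
      ...     | no avoids = b , HCopy⇒monoCopy F⁻ c c-sym (record
        { κ      = λ i → out (κ-avoids i)
        ; v      = out v-avoids
        ; clique = λ i≢j → below (κ-avoids _) (κ-avoids _) (HCopy.clique h i≢j)
        ; apex   = λ i → below v-avoids (κ-avoids _) (apex i)
        ; fresh  = λ i eq → fresh i (trans (sym (at v-avoids)) (trans (cong (inclusion F v) eq) (at (κ-avoids i)))) })
        where
        open HCopy h using (κ; apex; fresh)
        κ-avoids : ∀ i → v ≢ κ i
        κ-avoids i eq = avoids (just i , sym eq)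
        v-avoids : v ≢ HCopy.v h
        v-avoids eq = avoids (nothing , sym eq)
        at : ∀ {x} (v≢x : v ≢ x) → inclusion F v (out v≢x) ≡ x
        at v≢x = proj₂ (inclusion-onto F v v≢x)
        below : ∀ {x y b} (v≢x : v ≢ x) (v≢y : v ≢ y) → CC b x y → Coloured (Edgeᵍ F⁻) c b (out v≢x) (out v≢y)
        below v≢x v≢y (Exy , cxy) =
          trans (sym (inclusion-induced F v _ _)) (subst₂ (λ x y → E F x y ≡ true) (sym (at v≢x)) (sym (at v≢y)) Exy) ,
          trans (sym (base-inclusion _ _)) (trans (cong₂ base (at v≢x) (at v≢y)) (trans (sym (col-base v≢x v≢y)) cxy))

  lower-bound : ∀ F → RamseyMinimal F K → ∀ v → d * d ≤ deg F v
  lower-bound F (arr , minimal) v with d * d ≤? deg F v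
  ... | yes le = le
  ... | no ¬le = ⊥-elim (minimal (delVertex F v) (delVertex-proper F v)
                   (λ (c , c-sym) → LowerBound.extend F v (ℕₚ.≰⇒> ¬le) c c-sym arr))

  -- The upper bound

  does-true : ∀ {A : Set} (a? : Dec A) → does a? ≡ true → A
  does-true (yes a) _ = a

  F : Graph
  F = record
    { n    = Finite.size finF
    ; E    = λ i j → does (RF? (from i) (from j))
    ; symE = λ i j → symmetric (RF? (from i) (from j)) (RF? (from j) (from i))
    ; irr  = λ i → irreflexive (RF? (from i) (from i)) }
    where
    open Finite finF using (from)
    symmetric : ∀ {u w} (r : Dec (RF u w)) (r′ : Dec (RF w u)) → does r ≡ does r′
    symmetric (yes _) (yes _) = refl
    symmetric (no _)  (no _)  = refl
    symmetric {u} {w} (yes r) (no ¬r) = ⊥-elim (¬r (RF-sym {u} {w} r))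
    symmetric {u} {w} (no ¬r) (yes r) = ⊥-elim (¬r (RF-sym {w} {u} r))
    irreflexive : ∀ {u} (r : Dec (RF u u)) → does r ≡ false
    irreflexive {u} (yes r) = ⊥-elim (RF-irreflexive {u} r)
    irreflexive (no _) = refl

  open Finite finF using (to; from; to-injective; from-injective; from∘to)

  F-edge⇒ : ∀ {i j} → E F i j ≡ true → RF (from i) (from j)
  F-edge⇒ {i} {j} = does-true (RF? (from i) (from j))

  F-edge⇐ : ∀ {u w} → RF u w → E F (to u) (to w) ≡ true
  F-edge⇐ {u} {w} r = dec-true (RF? (from (to u)) (from (to w))) (subst₂ RF (sym (from∘to u)) (sym (from∘to w)) r)

  F-arrows : Arrows F K
  F-arrows (c , c-sym) with someMonoCopy? F K c
  ... | yes found = found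
  ... | no none   = ⊥-elim (Arrow.impossible (λ u w → c (to u) (to w)) (λ u w → c-sym (to u) (to w)) free)
    where
    free : ∀ b → ¬ HCopy (Coloured RF (λ u w → c (to u) (to w)) b)
    free b h = none (b , HCopy⇒monoCopy F c c-sym
      (HCopy-map to to-injective (λ {u} {w} (r , eq) → F-edge⇐ {u} {w} r , eq) h))

  module Minimal (F′ : Graph) (g : Fin (n F′) → Fin (n F)) (copy : IsCopy F′ F g) (minimal : RamseyMinimal F′ K) where

    at : Fin (n F′) → VF
    at i = from (g i)

    at-injective : ∀ {i j} → at i ≡ at j → i ≡ j
    at-injective = proj₁ copy ∘ from-injective

    at-edge : ∀ {i j} → E F′ i j ≡ true → RF (at i) (at j)
    at-edge Eij = F-edge⇒ (proj₂ copy _ _ Eij)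

    outer? : ∀ (u : VF) → Dec (∃ λ w → u ≡ inj₂ w)
    outer? (inj₁ x) = no λ ()
    outer? (inj₂ w) = yes (w , refl)

    module AllInner (none : ¬ ∃ λ i → ∃ λ w → at i ≡ inj₂ w) where

      inner : ∀ (u : VF) → ¬ (∃ λ w → u ≡ inj₂ w) → ∃ λ x → u ≡ inj₁ x
      inner (inj₁ x) _  = x , refl
      inner (inj₂ w) ¬w = ⊥-elim (¬w (w , refl))

      x : Fin (n F′) → System.V Q
      x i = proj₁ (inner (at i) (λ (w , eq) → none (i , w , eq)))

      at-x : ∀ i → at i ≡ inj₁ (x i)
      at-x i = proj₂ (inner (at i) (λ (w , eq) → none (i , w , eq)))

      x-injective : ∀ {i j} → x i ≡ x j → i ≡ j
      x-injective {i} {j} eq = at-injective (trans (at-x i) (trans (cong inj₁ eq) (sym (at-x j))))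

      colour : Fin (n F′) → Fin (n F′) → Bool
      colour i j = red-edge (x i) (x j)

      no-mono : ∀ {b} → ¬ MonoCopy F′ K colour b
      no-mono {b} mono = System.H-free Q b (HCopy-map x x-injective
        (λ {i} {j} (Eij , c) → red-edge-mono (subst₂ RF (at-x i) (at-x j) (at-edge Eij)) c)
        (monoCopy⇒HCopy F′ colour mono))

      impossible : ⊥
      impossible = no-mono (proj₂ (proj₁ minimal (colour , λ i j → red-edge-sym (x i) (x j))))

    small-degree : ∀ {i w} → at i ≡ inj₂ w → deg F′ i ≤ d * d
    small-degree {i} {w} at-i = subst (_≤ d * d) (sym (deg-neighbours F′ i))
      (coded-length (λ j c → at j ≡ inj₁ (entry c)) (neighbours-unique F′ i)
        (λ {j} j∈ → code (at j) (subst (λ u → RF u (at j)) at-i (at-edge (neighbours-adjacent F′ i j∈))))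
        (λ eq eq′ → at-injective (trans eq (sym eq′))))
      where
      entry : Fin (d * d) → System.V Q
      entry c = Vec.lookup (Vec.lookup w (proj₁ (Fin.remQuot {d} d c))) (proj₂ (Fin.remQuot {d} d c))
      code : ∀ u → RF (inj₂ w) u → ∃ λ c → u ≡ inj₁ (entry c)
      code (inj₁ x) (a , b , eq) = Fin.combine a b , cong inj₁ (trans (sym eq)
        (cong (λ (a , b) → Vec.lookup (Vec.lookup w a) b) (sym (Finₚ.remQuot-combine a b))))

    -- A new vertex must occur, as `Q` alone has an H-free colouring. Its neighbours are entries of
    -- one array, which may repeat and of which `F′` may keep only some, so this gives degree at
    -- most d²; equality comes from the lower bound.
    min-degree : MinDegreeIs F′ (d * d)
    min-degree with Finₚ.any? (λ i → outer? (at i))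
    ... | no none = ⊥-elim (AllInner.impossible none)
    ... | yes (i , w , at-i) = (i , ℕₚ.≤-antisym (small-degree at-i) (lower-bound F′ minimal i)) , lower-bound F′ minimal

  sIs-H : sIs (H t d) (d * d)
  sIs-H with minimal-subgraph K F F-arrows
  ... | F′ , (g , copy) , minimal = (F′ , minimal , Minimal.min-degree F′ g copy minimal) , lower-bound

theorem3p1 : (t d : ℕ) → 1 < d → d < t → sIs (H t d) (d * d)
theorem3p1 t d@(suc (suc d′)) (s≤s (s≤s z≤n)) d<t with ℕₚ.m≤n⇒∃[o]m+o≡n d<t
-- The hypothesis `d<t` means `suc d ≤ t`, so the difference is `e′` and t - d is its successor.
... | e′ , refl = subst (λ t → sIs (H t d) (d * d)) (ℕₚ.+-suc d e′) (Construction.sIs-H d′ e′)
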